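{- There are absolute constants $c_1,c_2,c_3>0$ such that for every sufficiently large odd prime power $q$ there are a split nondegenerate quadratic form $Q$ on $\mathbb F_q^4$ (i.e. of Witt index two), a nonempty set $P\subseteq\mathbb F_q^4$ and a nonempty family $\mathcal S$ of distinct $Q$-spheres with $$c_1q^{ -1}\le\mu(P,\mathcal S)\le c_2q^{ -1}\qquad\text{but}\qquad\operatorname{dist}_{\mathrm{lin}}(P,\mathcal S)\ge c_3q^{ -1/2}.$$ Consequently the exponent $1/2$ in the bound "$\operatorname{dist}_{\mathrm{lin}}(P,\mathcal S)\le2\sqrt{(d+1)\mu(P,\mathcal S)}$ whenever $\mu(P,\mathcal S)<(d+1)/(d+2)^2$" cannot be improved in general: for no constants $C>0$ and $e>1/2$ does $\operatorname{dist}_{\mathrm{lin}}(P,\mathcal S)\le C\mu(P,\mathcal S)^e$ hold for all such systems.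
   Context: For an odd prime power $q$ and a nondegenerate quadratic form $Q$ on $\mathbb F_q^d$ put $\langle x,y\rangle_Q=\frac{Q(x+y)-Q(x)-Q(y)}2$ and $S_Q(c,r)=\{x\in\mathbb F_q^d:Q(x-c)=r\}$ for $c\in\mathbb F_q^d$, $r\in\mathbb F_q$ (radius zero allowed); spheres are parametrized by pairs $(c,r)$ and distinct spheres means distinct parameter pairs. $I(P,\mathcal S)=|\{(p,S)\in P\times\mathcal S:p\in S\}|$ and $\mu(P,\mathcal S)=1-\frac{I(P,\mathcal S)}{|P||\mathcal S|}$. The lift is $\Phi(S_Q(c,r))=(2c,r-Q(c))\in\mathbb F_q^{d+1}$. For $x\in\mathbb F_q^d$, $y=(u,a)\in\mathbb F_q^d\times\mathbb F_q$ put $\Lambda_x(y)=Q(x)-\langle x,u\rangle_Q-a$. For a (nonempty) affine subspace $L\subseteq\mathbb F_q^{d+1}$ put $\mathcal S(L)=\Phi^{ -1}(L)$ and $B(L)=\{x\in\mathbb F_q^d:\Lambda_x(y)=0\ \forall y\in L\}$. Finally $$\operatorname{dist}_{\mathrm{lin}}(P,\mathcal S)=\inf_{L:\,B(L)\ne\varnothing}\left(\frac{|P\setminus B(L)|}{|P|}+\frac{|\mathcal S\setminus\mathcal S(L)|}{|\mathcal S|}\right).$$ -}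

module Defs where

open import Algebra.Bundles using (CommutativeRing)
open import Algebra.Core using (Op₁; Op₂)
open import Algebra.Structures using (IsCommutativeRing)
open import Algebra.Definitions.RawSemiring using (_^_)
open import Data.Fin.Base using (Fin)
open import Data.Fin.Properties using () renaming (_≟_ to _≟ᶠ_)
open import Data.Integer.Base using (+_)
open import Data.List.Base using (List; []; _∷_; length; filter; map; cartesianProduct; cartesianProductWith; allFin; _++_)
open import Data.List.Extrema using (argmin; f[argmin]≤v⁺)
open import Data.List.Membership.Propositional using (_∈_; lose)
open import Data.List.Membership.Propositional.Properties
  using (∈-map⁺; ∈-filter⁺; ∈-filter⁻; ∈-++⁺ˡ; ∈-++⁺ʳ; ∈-allFin; ∈-cartesianProduct⁺; ∈-cartesianProductWith⁺)
open import Data.List.Properties using (filter-≐)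
import Data.List.Membership.DecPropositional as DecMembership
open import Data.List.Relation.Unary.All as All using (All; all?)
open import Data.List.Relation.Unary.Any as Any using (Any; any?; here; there)
open import Data.List.Relation.Unary.Unique.Propositional using (Unique)
open import Data.Nat.Base as ℕ using (ℕ; zero; suc; NonZero)
open import Data.Nat.Divisibility using (_∣_)
open import Data.Nat.Primality using (Prime)
open import Data.Nat.Properties using (m*n≢0)
open import Data.Product using (Σ; ∃; ∃-syntax; _×_; _,_; proj₁; proj₂)
open import Data.Product.Properties using (≡-dec)
open import Data.Rational.Base as ℚ using (ℚ; 0ℚ; 1ℚ; _/_)
import Data.Rational.Properties as ℚₚ
open import Data.Sum using (_⊎_; inj₁; inj₂)
open import Data.Vec.Base as Vec using (Vec; []; _∷_; zipWith; replicate; foldr′)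
import Data.Vec.Properties as Vecₚ
open import Function.Base using (_∘_)
open import Function.Bundles using (_↔_; Inverse; _⇔_)
open import Level using (0ℓ)
open import Relation.Binary.Bundles using (TotalOrder; DecTotalOrder)
open import Relation.Binary.Definitions using (DecidableEquality)
open import Relation.Binary.PropositionalEquality
open import Relation.Nullary using (¬_; Dec; yes; no; contradiction)
open import Relation.Nullary.Decidable using (¬?; _×-dec_; map′; _→-dec_)
import Relation.Unary as U

OddPrimePower : ℕ → Set
OddPrimePower q = ¬ (2 ∣ q) × ∃[ p ] ∃[ k ] (Prime p × 1 ℕ.≤ k × q ≡ p ℕ.^ k)

record FiniteField (q : ℕ) : Set₁ where
  infixl 6 _+_ _-_
  infixl 7 _*_
  field
    Carrier           : Set
    _+_ _*_           : Op₂ Carrier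
    -_                : Op₁ Carrier
    0# 1#             : Carrier
    isCommutativeRing : IsCommutativeRing _≡_ _+_ _*_ -_ 0# 1#
    0≢1               : 0# ≢ 1#
    _⁻¹               : Op₁ Carrier
    -- The value of 0# ⁻¹ is unconstrained.
    *-inverseʳ        : ∀ x → x ≢ 0# → x * (x ⁻¹) ≡ 1#
    enumeration       : Carrier ↔ Fin q

  open IsCommutativeRing isCommutativeRing public using
    (+-assoc; +-comm; +-identityˡ; +-identityʳ; -‿inverseˡ; -‿inverseʳ;
     *-assoc; *-comm; *-identityˡ; *-identityʳ; distribˡ; distribʳ; zeroˡ; zeroʳ)

  commutativeRing : CommutativeRing 0ℓ 0ℓ
  commutativeRing = record { isCommutativeRing = isCommutativeRing }

  _-_ : Op₂ Carrier
  x - y = x + (- y)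

  2# : Carrier
  2# = 1# + 1#

  infix 4 _≟_
  _≟_ : DecidableEquality Carrier
  x ≟ y = map′ injective (cong (Inverse.to enumeration))
                (Inverse.to enumeration x ≟ᶠ Inverse.to enumeration y)
    where
    injective : Inverse.to enumeration x ≡ Inverse.to enumeration y → x ≡ y
    injective eq = trans (sym (Inverse.strictlyInverseʳ enumeration x))
                  (trans (cong (Inverse.from enumeration) eq)
                         (Inverse.strictlyInverseʳ enumeration y))

  elements : List Carrier
  elements = map (Inverse.from enumeration) (allFin q)

  ∈-elements : ∀ x → x ∈ elements
  ∈-elements x = subst (_∈ elements) (Inverse.strictlyInverseʳ enumeration x)
                   (∈-map⁺ (Inverse.from enumeration) (∈-allFin (Inverse.to enumeration x)))

  infixl 6 _+ᵥ_ _-ᵥ_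
  infixr 7 _·ᵥ_

  _+ᵥ_ _-ᵥ_ : ∀ {d} → Op₂ (Vec Carrier d)
  _+ᵥ_ = zipWith _+_
  _-ᵥ_ = zipWith _-_

  _·ᵥ_ : ∀ {d} → Carrier → Vec Carrier d → Vec Carrier d
  t ·ᵥ x = Vec.map (t *_) x

  0ᵥ : ∀ {d} → Vec Carrier d
  0ᵥ = replicate _ 0#

  linearCombination : ∀ {d m} → Vec Carrier m → Vec (Vec Carrier d) m → Vec Carrier d
  linearCombination ts vs = foldr′ _+ᵥ_ 0ᵥ (zipWith _·ᵥ_ ts vs)

  LinearlyIndependent : ∀ {d m} → Vec (Vec Carrier d) m → Set
  LinearlyIndependent vs = ∀ ts → linearCombination ts vs ≡ 0ᵥ → ts ≡ 0ᵥ

  vectors : ∀ d → List (Vec Carrier d)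
  vectors zero    = [] ∷ []
  vectors (suc d) = cartesianProductWith _∷_ elements (vectors d)

  ∈-vectors : ∀ {d} (x : Vec Carrier d) → x ∈ vectors d
  ∈-vectors []      = here refl
  ∈-vectors (a ∷ x) = ∈-cartesianProductWith⁺ _∷_ (∈-elements a) (∈-vectors x)

Point : ∀ {q} → FiniteField q → ℕ → Set
Point F d = Vec (FiniteField.Carrier F) d

record QuadraticForm {q} (F : FiniteField q) (d : ℕ) : Set where
  open FiniteField F
  field
    form : Point F d → Carrier

  ⟨_,_⟩ : Point F d → Point F d → Carrier
  ⟨ x , y ⟩ = (form (x +ᵥ y) - form x - form y) * (2# ⁻¹)

  -- Intended for fields of odd order; symmetry then gives linearity in the second argument.
  field
    form-homogeneous  : ∀ t x → form (t ·ᵥ x) ≡ (t * t) * form x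
    ⟨⟩-additiveˡ      : ∀ x y z → ⟨ x +ᵥ y , z ⟩ ≡ ⟨ x , z ⟩ + ⟨ y , z ⟩
    ⟨⟩-homogeneousˡ   : ∀ t x y → ⟨ t ·ᵥ x , y ⟩ ≡ t * ⟨ x , y ⟩

module _ {q} {F : FiniteField q} {d : ℕ} (Q : QuadraticForm F d) where
  open FiniteField F
  open QuadraticForm Q

  Nondegenerate : Set
  Nondegenerate = ∀ x → (∀ y → ⟨ x , y ⟩ ≡ 0#) → x ≡ 0ᵥ

  -- The listed vectors span an m-dimensional subspace on which the form vanishes.
  TotallyIsotropicBasis : ∀ {m} → Vec (Point F d) m → Set
  TotallyIsotropicBasis vs =
    LinearlyIndependent vs × (∀ ts → form (linearCombination ts vs) ≡ 0#)

  WittIndex : ℕ → Set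
  WittIndex m = (∃[ vs ] TotallyIsotropicBasis {m} vs)
              × (∀ n (vs : Vec (Point F d) n) → TotallyIsotropicBasis vs → n ℕ.≤ m)

record NonemptyFiniteSet (A : Set) : Set where
  field
    members         : List A
    distinct        : Unique members
    ⦃ nonempty ⦄    : NonZero (length members)

open NonemptyFiniteSet public using (members)

∣_∣ : ∀ {A} → NonemptyFiniteSet A → ℕ
∣ P ∣ = length (members P)

instance
  ∣∣-nonZero : ∀ {A} {P : NonemptyFiniteSet A} → NonZero ∣ P ∣
  ∣∣-nonZero {P = P} = NonemptyFiniteSet.nonempty P

-- (c , r) is the sphere with centre c and radius r; spheres are equal exactly when their
-- parameters are.
Sphere : ∀ {q} → FiniteField q → ℕ → Set
Sphere F d = Point F d × FiniteField.Carrier F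

LiftPoint : ∀ {q} → FiniteField q → ℕ → Set
LiftPoint F d = Point F d × FiniteField.Carrier F

module _ {q} (F : FiniteField q) (d : ℕ) where
  open FiniteField F

  infixl 6 _+ₗ_ _-ₗ_
  infixr 7 _·ₗ_

  _+ₗ_ _-ₗ_ : Op₂ (LiftPoint F d)
  (u , a) +ₗ (v , b) = u +ᵥ v , a + b
  (u , a) -ₗ (v , b) = u -ᵥ v , a - b

  _·ₗ_ : Carrier → LiftPoint F d → LiftPoint F d
  t ·ₗ (u , a) = t ·ᵥ u , t * a

  0ₗ : LiftPoint F d
  0ₗ = 0ᵥ , 0#

  record IsLinearSubspace (W : LiftPoint F d → Set) : Set where
    field
      0-closed : W 0ₗ
      +-closed : ∀ y z → W y → W z → W (y +ₗ z)
      ·-closed : ∀ t y → W y → W (t ·ₗ y)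

  -- Restricting to decidable subspaces only serves to make cardinalities computable:
  -- classically every subset of a finite set is decidable.
  record AffineSubspace : Set₁ where
    field
      base              : LiftPoint F d
      Direction         : LiftPoint F d → Set
      direction?        : U.Decidable Direction
      isLinearSubspace  : IsLinearSubspace Direction

    Member : LiftPoint F d → Set
    Member y = Direction (y -ₗ base)

    member? : U.Decidable Member
    member? y = direction? (y -ₗ base)

  _≟ₗ_ : DecidableEquality (LiftPoint F d)
  _≟ₗ_ = ≡-dec (Vecₚ.≡-dec _≟_) _≟_

  liftPoints : List (LiftPoint F d)
  liftPoints = cartesianProduct (vectors d) elements

  ∈-liftPoints : ∀ y → y ∈ liftPoints
  ∈-liftPoints (u , a) = ∈-cartesianProduct⁺ (∈-vectors u) (∈-elements a)

private
  ≤-totalOrder : TotalOrder 0ℓ 0ℓ 0ℓ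
  ≤-totalOrder = DecTotalOrder.totalOrder ℚₚ.≤-decTotalOrder

IsInfimum : ∀ {i} {I : Set i} → (I → ℚ) → ℚ → Set i
IsInfimum f m = (∀ i → m ℚ.≤ f i) × (∀ m′ → (∀ i → m′ ℚ.≤ f i) → m′ ℚ.≤ m)

private
  finite-infimum : ∀ {i} {I : Set i} {A : Set} (f : I → ℚ) (g : A → I) (a₀ : A) (as : List A) →
                   (∀ i → ∃[ a ] (a ∈ as × f (g a) ≡ f i)) → ∃[ m ] IsInfimum f m
  finite-infimum f g a₀ as cover = f (g best) , lower , λ m′ h → h (g best)
    where
    best = argmin ≤-totalOrder (f ∘ g) a₀ as
    lower : ∀ i → f (g best) ℚ.≤ f i
    lower i with a , a∈as , eq ← cover i =
      f[argmin]≤v⁺ ≤-totalOrder {f = f ∘ g} a₀ as (inj₂ (lose a∈as (ℚₚ.≤-reflexive eq)))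

  ∀-dec : ∀ {a p} {A : Set a} {P : A → Set p} (xs : List A) → (∀ x → x ∈ xs) →
          U.Decidable P → Dec (∀ x → P x)
  ∀-dec xs complete P? =
    map′ (λ ps x → All.lookup ps (complete x)) (λ f → All.tabulate λ {x} _ → f x) (all? P? xs)

  ∃-dec : ∀ {a p} {A : Set a} {P : A → Set p} (xs : List A) → (∀ x → x ∈ xs) →
          U.Decidable P → Dec (∃ P)
  ∃-dec xs complete P? = map′ Any.satisfied (λ (x , px) → lose (complete x) px) (any? P? xs)

  sublists : ∀ {A : Set} → List A → List (List A)
  sublists []       = [] ∷ []
  sublists (x ∷ xs) = sublists xs ++ map (x ∷_) (sublists xs)

  filter∈sublists : ∀ {A : Set} {P : A → Set} (P? : U.Decidable P) xs →
                    filter P? xs ∈ sublists xs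
  filter∈sublists P? [] = here refl
  filter∈sublists P? (x ∷ xs) with P? x
  ... | yes _ = ∈-++⁺ʳ (sublists xs) (∈-map⁺ (x ∷_) (filter∈sublists P? xs))
  ... | no  _ = ∈-++⁺ˡ (filter∈sublists P? xs)

module _ {q} {F : FiniteField q} {d : ℕ} (Q : QuadraticForm F d) where
  open FiniteField F
  open QuadraticForm Q
  open AffineSubspace

  OnSphere : Point F d → Sphere F d → Set
  OnSphere x (c , r) = form (x -ᵥ c) ≡ r

  onSphere? : ∀ x s → Dec (OnSphere x s)
  onSphere? x (c , r) = form (x -ᵥ c) ≟ r

  incidences : NonemptyFiniteSet (Point F d) → NonemptyFiniteSet (Sphere F d) → ℕ
  incidences P S =
    length (filter (λ (p , s) → onSphere? p s) (cartesianProduct (members P) (members S)))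

  μ : NonemptyFiniteSet (Point F d) → NonemptyFiniteSet (Sphere F d) → ℚ
  μ P S = 1ℚ ℚ.- _/_ (+ incidences P S) (∣ P ∣ ℕ.* ∣ S ∣) ⦃ m*n≢0 ∣ P ∣ ∣ S ∣ ⦄

  Φ : Sphere F d → LiftPoint F d
  Φ (c , r) = 2# ·ᵥ c , r - form c

  Λ : Point F d → LiftPoint F d → Carrier
  Λ x (u , a) = form x - ⟨ x , u ⟩ - a

  𝒮 : AffineSubspace F d → Sphere F d → Set
  𝒮 L s = Member L (Φ s)

  B : AffineSubspace F d → Point F d → Set
  B L x = ∀ y → Member L y → Λ x y ≡ 0#

  𝒮? : ∀ L → U.Decidable (𝒮 L)
  𝒮? L s = member? L (Φ s)

  B? : ∀ L → U.Decidable (B L)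
  B? L x = ∀-dec (liftPoints F d) (∈-liftPoints F d) λ y → member? L y →-dec (Λ x y ≟ 0#)

  -- The index set of the infimum defining the linear distance.
  AdmissibleSubspace : Set₁
  AdmissibleSubspace = Σ (AffineSubspace F d) λ L → ∃[ x ] B L x

  defect : NonemptyFiniteSet (Point F d) → NonemptyFiniteSet (Sphere F d) →
           AdmissibleSubspace → ℚ
  defect P S (L , _) =
    (+ length (filter (¬? ∘ B? L) (members P)) / ∣ P ∣)
      ℚ.+ (+ length (filter (¬? ∘ 𝒮? L) (members S)) / ∣ S ∣)

  private
    Y = LiftPoint F d
    _-ₗ′_ = _-ₗ_ F d
    open DecMembership (_≟ₗ_ F d) using (_∈?_)

    isLinearSubspace? : ∀ W → Dec (IsLinearSubspace F d (_∈ W))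
    isLinearSubspace? W = map′
      (λ (z , p , s) → record { 0-closed = z ; +-closed = p ; ·-closed = s })
      (λ h → let open IsLinearSubspace h in 0-closed , +-closed , ·-closed)
      ((0ₗ F d ∈? W)
        ×-dec ∀Y (λ y → ∀Y λ z → y ∈? W →-dec (z ∈? W →-dec (_+ₗ_ F d y z ∈? W)))
        ×-dec ∀-dec elements ∈-elements (λ t → ∀Y λ y → y ∈? W →-dec (_·ₗ_ F d t y ∈? W)))
      where
      ∀Y : ∀ {P : Y → Set} → U.Decidable P → Dec (∀ y → P y)
      ∀Y = ∀-dec (liftPoints F d) (∈-liftPoints F d)

    candidate : ∀ y₀ W → IsLinearSubspace F d (_∈ W) → AffineSubspace F d
    candidate y₀ W h = record
      { base = y₀ ; Direction = _∈ W ; direction? = _∈? W ; isLinearSubspace = h }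

    Good : Y × List Y → Set
    Good (y₀ , W) = Σ (IsLinearSubspace F d (_∈ W)) λ h → ∃[ x ] B (candidate y₀ W h) x

    -- B depends on the members only, so any linearity proof serves.
    good? : U.Decidable Good
    good? (y₀ , W) with isLinearSubspace? W
    ... | no ¬h = no (¬h ∘ proj₁)
    ... | yes h = map′ (h ,_) proj₂ (∃-dec (vectors d) ∈-vectors (B? (candidate y₀ W h)))

    ·ᵥ-zero : ∀ {n} (x : Vec Carrier n) → 0# ·ᵥ x ≡ 0ᵥ
    ·ᵥ-zero []      = refl
    ·ᵥ-zero (a ∷ x) = cong₂ _∷_ (zeroˡ a) (·ᵥ-zero x)

    ·ᵥ-0 : ∀ t n → t ·ᵥ 0ᵥ {n} ≡ 0ᵥ
    ·ᵥ-0 t zero    = refl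
    ·ᵥ-0 t (suc n) = cong₂ _∷_ (zeroʳ t) (·ᵥ-0 t n)

    0+0 : ∀ n → 0ᵥ {n} +ᵥ 0ᵥ ≡ 0ᵥ
    0+0 zero    = refl
    0+0 (suc n) = cong₂ _∷_ (+-identityˡ 0#) (0+0 n)

    x-0 : ∀ x → x - 0# ≡ x
    x-0 x = trans (cong (λ z → x + z) (trans (sym (+-identityˡ _)) (-‿inverseʳ 0#))) (+-identityʳ x)

    x-0ᵥ : ∀ {n} (x : Vec Carrier n) → x -ᵥ 0ᵥ ≡ x
    x-0ᵥ []      = refl
    x-0ᵥ (a ∷ x) = cong₂ _∷_ (x-0 a) (x-0ᵥ x)

    Λ-0 : Λ 0ᵥ (0ₗ F d) ≡ 0#
    Λ-0 = trans (x-0 _) (trans (cong₂ _-_ form-0 ⟨0,0⟩) (x-0 0#))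
      where
      form-0 : form 0ᵥ ≡ 0#
      form-0 = trans (cong form (sym (·ᵥ-zero 0ᵥ)))
              (trans (form-homogeneous 0# 0ᵥ) (trans (cong (_* form 0ᵥ) (zeroˡ 0#)) (zeroˡ _)))
      ⟨0,0⟩ : ⟨ 0ᵥ , 0ᵥ ⟩ ≡ 0#
      ⟨0,0⟩ = trans (cong ⟨_, 0ᵥ ⟩ (sym (·ᵥ-zero 0ᵥ))) (trans (⟨⟩-homogeneousˡ 0# 0ᵥ 0ᵥ) (zeroˡ _))

    origin : AdmissibleSubspace
    origin = L , 0ᵥ , λ y eq → trans (cong (Λ 0ᵥ) (trans (sym (-0ₗ y)) eq)) Λ-0
      where
      -0ₗ : ∀ y → _-ₗ_ F d y (0ₗ F d) ≡ y
      -0ₗ (u , a) = cong₂ _,_ (x-0ᵥ u) (x-0 a)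
      L : AffineSubspace F d
      L = record
        { base = 0ₗ F d ; Direction = _≡ 0ₗ F d ; direction? = λ y → _≟ₗ_ F d y (0ₗ F d)
        ; isLinearSubspace = record
          { 0-closed = refl
          ; +-closed = λ { _ _ refl refl → cong₂ _,_ (0+0 d) (+-identityˡ 0#) }
          ; ·-closed = λ { t _ refl → cong₂ _,_ (·ᵥ-0 t d) (zeroʳ t) } } }

    fromDec : ∀ c → Dec (Good c) → AdmissibleSubspace
    fromDec (y₀ , W) (yes (h , b)) = candidate y₀ W h , b
    fromDec _ (no _) = origin

    decode : Y × List Y → AdmissibleSubspace
    decode c = fromDec c (good? c)

    codes : List (Y × List Y)
    codes = cartesianProduct (liftPoints F d) (sublists (liftPoints F d))

  module _ (P : NonemptyFiniteSet (Point F d)) (S : NonemptyFiniteSet (Sphere F d)) where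
    private
      defect-cong : ∀ (L M : AdmissibleSubspace) →
        (∀ y → Member (proj₁ L) y → Member (proj₁ M) y) →
        (∀ y → Member (proj₁ M) y → Member (proj₁ L) y) →
        defect P S L ≡ defect P S M
      defect-cong (L , _) (M , _) f g = cong₂ ℚ._+_
        (cong (λ xs → + length xs / ∣ P ∣) (filter-≐ (¬? ∘ B? L) (¬? ∘ B? M)
          ( (λ ¬b b → ¬b λ y m → b y (f y m)) , (λ ¬b b → ¬b λ y m → b y (g y m))) (members P)))
        (cong (λ xs → + length xs / ∣ S ∣) (filter-≐ (¬? ∘ 𝒮? L) (¬? ∘ 𝒮? M)
          ((λ ¬s s → ¬s (g _ s)) , (λ ¬s s → ¬s (f _ s))) (members S)))

      encode : AdmissibleSubspace → Y × List Y
      encode (L , _) = base L , filter (direction? L) (liftPoints F d)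

      encode∈codes : ∀ L → encode L ∈ codes
      encode∈codes (L , _) =
        ∈-cartesianProduct⁺ (∈-liftPoints F d (base L)) (filter∈sublists (direction? L) (liftPoints F d))

      ∈-encode⁻ : ∀ L {y} → y ∈ proj₂ (encode L) → Direction (proj₁ L) y
      ∈-encode⁻ (L , _) y∈ = proj₂ (∈-filter⁻ (direction? L) {xs = liftPoints F d} y∈)

      ∈-encode⁺ : ∀ L {y} → Direction (proj₁ L) y → y ∈ proj₂ (encode L)
      ∈-encode⁺ (L , _) = ∈-filter⁺ (direction? L) (∈-liftPoints F d _)

      fromDec-encode : ∀ L (g : Dec (Good (encode L))) →
                       defect P S (fromDec (encode L) g) ≡ defect P S L
      fromDec-encode L (yes (h , b)) =
        defect-cong (fromDec (encode L) (yes (h , b))) L (λ y → ∈-encode⁻ L {y -ₗ′ base (proj₁ L)}) (λ y → ∈-encode⁺ L {y -ₗ′ base (proj₁ L)})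
      fromDec-encode L@(L₀ , x , bx) (no ¬good) = contradiction
        (record { 0-closed = ∈-encode⁺ L 0-closed
                ; +-closed = λ y z p r → ∈-encode⁺ L (+-closed y z (∈-encode⁻ L p) (∈-encode⁻ L r))
                ; ·-closed = λ t y p → ∈-encode⁺ L (·-closed t y (∈-encode⁻ L p)) }
        , x , λ y m → bx y (∈-encode⁻ L m)) ¬good
        where open IsLinearSubspace (isLinearSubspace L₀)

    abstract
      defect-infimum : ∃[ m ] IsInfimum (defect P S) m
      defect-infimum = finite-infimum (defect P S) decode (0ₗ F d , []) codes
        λ L → encode L , encode∈codes L , fromDec-encode L (good? (encode L))

    distLin : ℚ
    distLin = proj₁ defect-infimum

    distLin-isInfimum : IsInfimum (defect P S) distLin
    distLin-isInfimum = proj₂ defect-infimum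

-- Dedekind reals: Below r and Above r mean that the rational r is strictly smaller,
-- respectively strictly larger, than the real number.
record ℝ : Set₁ where
  field
    Below Above     : ℚ → Set
    below-inhabited : ∃ Below
    above-inhabited : ∃ Above
    below-rounded   : ∀ r → Below r ⇔ (∃[ s ] (r ℚ.< s × Below s))
    above-rounded   : ∀ r → Above r ⇔ (∃[ s ] (s ℚ.< r × Above s))
    disjoint        : ∀ r → ¬ (Below r × Above r)
    located         : ∀ r s → r ℚ.< s → Below r ⊎ Above s

open ℝ public using (Below; Above)

infixr 8 _^ℚ_
_^ℚ_ : ℚ → ℕ → ℚ
_^ℚ_ = _^_ ℚ.+-*-rawSemiring

-- y ≤ C · x ^ e for rationals y ≥ 0 and 0 ≤ x ≤ 1 and reals C > 0 and e > 0. For such x the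
-- number C · x ^ e is the infimum of c · x ^ (m / n) over the rationals c > C and
-- 0 ≤ m / n < e, and y ≤ c · x ^ (m / n) amounts to y ^ n ≤ c ^ n · x ^ m.
PowerBound : ℚ → ℝ → ℚ → ℝ → Set
PowerBound y C x e =
  ∀ c → Above C c → ∀ m n ⦃ _ : NonZero n ⦄ → Below e (+ m / n) →
  y ^ℚ n ℚ.≤ (c ^ℚ n) ℚ.* (x ^ℚ m)

-- c · √x ≤ y for rationals c ≥ 0 and x ≥ 0.
SqrtBound : ℚ → ℚ → ℚ → Set
SqrtBound c x y = 0ℚ ℚ.≤ y × (c ^ℚ 2) ℚ.* x ℚ.≤ y ^ℚ 2

-- With hyperbolic coordinates Q(x, y) = x · y on F² × F², the points (s , 0 , 0 , 0) and (0 , s , 0 , 0)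
-- and the radius-zero spheres centred at (t , 0 , 0 , 0) and (0 , 0 , 0 , t) are incident except for
-- the second kind of point against the second kind of sphere (s , t ≠ 0). Taking all q parameters in
-- the first kinds and k ≈ √q nonzero ones in the second kinds gives μ = (k / (q + k))² ≈ 1 / q. If B(L)
-- contains a point of the second kind, then 𝒮(L) contains no sphere of the second kind, so every defect
-- is at least k / (q + k) = √μ. For the optimality of the exponent this is applied over the fields
-- of integers modulo large primes.

module Submission where

open import Defs
open import Algebra.Bundles using (CommutativeRing; CommutativeSemiring; Ring)
import Algebra.Properties.CommutativeMonoid.Sum as SumProperties
import Algebra.Properties.Group as GroupProperties
import Algebra.Properties.Monoid.Mult as MultProperties
import Algebra.Properties.Ring as RingProperties
import Algebra.Solver.Ring.NaturalCoefficients.Default as SemiringSolver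
open import Algebra.Structures using (IsCommutativeRing)
open import Data.Fin.Base using (Fin; zero; suc; toℕ; fromℕ<)
open import Data.Fin.Properties using (toℕ-injective; toℕ-fromℕ<; toℕ<n) renaming (_≟_ to _≟ᶠ_)
import Data.Integer.Properties as ℤₚ
open import Data.List.Base using (List; []; _∷_; _++_; length; filter; map; take; allFin; cartesianProduct)
open import Data.List.Membership.Propositional using (_∈_; find)
open import Data.List.Membership.Propositional.Properties using (∈-map⁻)
open import Data.List.Properties
  using (length-map; length-++; length-take; length-tabulate; filter-++; filter-all; filter-none;
         cartesianProductWith-distribʳ-++)
open import Data.List.Relation.Unary.All as All using (All; []; _∷_)
import Data.List.Relation.Unary.All.Properties as Allₚ
open import Data.List.Relation.Unary.AllPairs using ([]; _∷_)
open import Data.List.Relation.Unary.Any using (Any; any?)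
open import Data.List.Relation.Unary.Unique.Propositional using (Unique)
import Data.List.Relation.Unary.Unique.Propositional.Properties as Uniqueₚ
open import Data.Nat.Base as ℕ using (ℕ; zero; suc; NonZero; z≤n; s≤s; _∸_; _%_; _!)
open import Data.Nat.Coprimality using (prime⇒coprime; coprime-Bézout)
open import Data.Nat.Divisibility using (_∣_; ∣1⇒≡1; ∣m+n∣m⇒∣n; ∣-trans; m∣m*n; m≤n⇒m!∣n!; m%n≡0⇒n∣m)
open import Data.Nat.DivMod
  using (m%n<n; m<n⇒m%n≡m; m≡m%n+[m/n]*n; %-distribˡ-+; %-distribˡ-*; n%n≡0; m*n%n≡0)
open import Data.Nat.GCD using (module Bézout)
open import Data.Nat.Primality
  using (Prime; prime⇒nonZero; prime⇒nonTrivial; prime⇒irreducible; ¬prime[1])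
open import Data.Nat.Primality.Factorisation using (factorise)
import Data.Nat.Properties as ℕₚ
open import Data.Nat.Tactic.RingSolver using (solve-∀)
open import Data.Product using (∃-syntax; Σ-syntax; _×_; _,_; proj₁; proj₂)
open import Data.Rational.Base as ℚ using (ℚ; mkℚ; 0ℚ; 1ℚ; ½; _/_; toℚᵘ; ↥_)
import Data.Rational.Properties as ℚₚ
open import Data.Rational.Unnormalised.Base as ℚᵘ using (mkℚᵘ)
import Data.Rational.Unnormalised.Properties as ℚᵘₚ
open import Data.Sum using (_⊎_; inj₁; inj₂; [_,_]′)
open import Data.Vec.Base as Vec using (Vec; []; _∷_; lookup; removeAt)
import Data.Vec.Properties as Vecₚ
open import Function.Base using (_∘_)
open import Function.Bundles using (_↔_; Equivalence; Inverse; mk↔ₛ′)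
open import Function.Construct.Identity using (↔-id)
open import Relation.Binary.Definitions using (DecidableEquality)
open import Relation.Binary.PropositionalEquality hiding ([_])
open import Relation.Nullary using (¬_; yes; no; contradiction)
open import Relation.Nullary.Decidable using (¬?; toSum)
import Relation.Unary as U

-- Finite fields

-- The hyperbolic pairs are the coordinates 1, 3 and 2, 4, so Witt index two leaves room for three
-- isotropic coordinate directions 1, 2, 4 of which only one pair, 2 and 4, is nonorthogonal. All
-- failures of incidence then form a single k by k block. Since `μ` is exactly the square of x = k /
-- (q + k), the inequality distance ≥ √μ holds for every k used; k ≈ √q only fixes the scale 1 / q.
-- A bound with constant C and exponent e would give x ≤ C x^(2e), which fails for small x once 2e >
-- 1. With e replaced by a fraction m / n and C by a natural number, this becomes an inequality
-- between natural numbers. Two facts do not come for free. A `FiniteField` is known only through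
-- its order, so 2 ≠ 0 has to be extracted from the oddness of q. And Witt index two includes an
-- upper bound on all totally isotropic families, which calls for linear dependence in coordinate
-- spaces.

module FieldProperties {q} (F : FiniteField q) where
  open FiniteField F

  private
    ring : Ring _ _
    ring = CommutativeRing.ring commutativeRing

    commutativeSemiring : CommutativeSemiring _ _
    commutativeSemiring = CommutativeRing.commutativeSemiring commutativeRing

  open RingProperties ring using (-‿distribˡ-*; -‿distribʳ-*)
  open GroupProperties (Ring.+-group ring) using (identityʳ-unique)
    renaming (⁻¹-involutive to -‿involutive; ε⁻¹≈ε to -0≡0)
  open SemiringSolver commutativeSemiring using (solve; _:+_; _:*_; _:=_; con)
  open ≡-Reasoning

  x-0≡x : ∀ x → x - 0# ≡ x
  x-0≡x x = trans (cong (x +_) -0≡0) (+-identityʳ x)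

  x+y-x≡y : ∀ x y → x + y - x ≡ y
  x+y-x≡y x y = begin
    x + y - x      ≡⟨ cong (_- x) (+-comm x y) ⟩
    y + x - x      ≡⟨ +-assoc y x (- x) ⟩
    y + (x - x)    ≡⟨ cong (y +_) (-‿inverseʳ x) ⟩
    y + 0#         ≡⟨ +-identityʳ y ⟩
    y              ∎

  x*y≡0⇒y≡0 : ∀ {x y} → x ≢ 0# → x * y ≡ 0# → y ≡ 0#
  x*y≡0⇒y≡0 {x} {y} x≢0 xy≡0 = begin
    y                   ≡⟨ *-identityˡ y ⟨
    1# * y              ≡⟨ cong (_* y) (*-inverseʳ x x≢0) ⟨
    x * x ⁻¹ * y        ≡⟨ solve 3 (λ x i y → x :* i :* y := i :* (x :* y)) refl x (x ⁻¹) y ⟩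
    x ⁻¹ * (x * y)      ≡⟨ cong (x ⁻¹ *_) xy≡0 ⟩
    x ⁻¹ * 0#           ≡⟨ zeroʳ (x ⁻¹) ⟩
    0#                  ∎

  x*y≡0⇒x≡0 : ∀ {x y} → y ≢ 0# → x * y ≡ 0# → x ≡ 0#
  x*y≡0⇒x≡0 {x} {y} y≢0 xy≡0 = x*y≡0⇒y≡0 y≢0 (trans (*-comm y x) xy≡0)

  *-≢0 : ∀ {x y} → x ≢ 0# → y ≢ 0# → x * y ≢ 0#
  *-≢0 x≢0 y≢0 = y≢0 ∘ x*y≡0⇒y≡0 x≢0

  -‿≢0 : ∀ {x} → x ≢ 0# → - x ≢ 0#
  -‿≢0 {x} x≢0 -x≡0 = x≢0 (trans (sym (-‿involutive x)) (trans (cong -_ -x≡0) -0≡0))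

  ⁻¹-≢0 : ∀ {x} → x ≢ 0# → x ⁻¹ ≢ 0#
  ⁻¹-≢0 {x} x≢0 i≡0 = 0≢1 (trans (sym (zeroʳ x)) (trans (cong (x *_) (sym i≡0)) (*-inverseʳ x x≢0)))

  module _ where
    open MultProperties (Ring.+-monoid ring) using (×-homo-+; ×-assocˡ) renaming (_×_ to _×ᶠ_)
    open SumProperties (Ring.+-commutativeMonoid ring) using (sum; ∑-distrib-+; ∑-permute; sum-cong-≗; sum-replicate)

    private
      open Inverse enumeration using (to; from; strictlyInverseˡ; strictlyInverseʳ)

      translation : Fin q ↔ Fin q
      translation = mk↔ₛ′ (λ i → to (from i + 1#)) (λ i → to (from i - 1#))
        (λ i → trans (cong (λ x → to (x + 1#)) (strictlyInverseʳ _))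
                (trans (cong to (trans (+-assoc (from i) (- 1#) 1#)
                  (trans (cong (from i +_) (-‿inverseˡ 1#)) (+-identityʳ _)))) (strictlyInverseˡ i)))
        (λ i → trans (cong (λ x → to (x - 1#)) (strictlyInverseʳ _))
                (trans (cong to (trans (+-assoc (from i) 1# (- 1#))
                  (trans (cong (from i +_) (-‿inverseʳ 1#)) (+-identityʳ _)))) (strictlyInverseˡ i)))

    -- Translation by 1 permutes the field, so it does not change the sum of all elements.
    order×1≡0 : q ×ᶠ 1# ≡ 0#
    order×1≡0 = identityʳ-unique (sum from) (q ×ᶠ 1#) (begin
      sum from + q ×ᶠ 1#                          ≡⟨ cong (sum from +_) (sum-replicate q) ⟨
      sum from + sum {q} (λ _ → 1#)               ≡⟨ ∑-distrib-+ from (λ _ → 1#) ⟨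
      sum (λ i → from i + 1#)                     ≡⟨ sum-cong-≗ (λ i → sym (strictlyInverseʳ (from i + 1#))) ⟩
      sum (λ i → from (to (from i + 1#)))         ≡⟨ ∑-permute from translation ⟨
      sum from                                    ∎)

    -- Writing q = 1 + 2h, the vanishing of `2#` would turn `order×1≡0` into 1 = 0.
    2≢0 : ¬ (2 ∣ q) → 2# ≢ 0#
    2≢0 ¬2∣q 2≡0 with q ℕ.% 2 in eq | m%n<n q 2
    ... | 0 | _ = ¬2∣q (m%n≡0⇒n∣m q 2 eq)
    ... | 1 | _ = 0≢1 (begin
      0#                                        ≡⟨ order×1≡0 ⟨
      q ×ᶠ 1#
        ≡⟨ cong (_×ᶠ 1#) (trans (m≡m%n+[m/n]*n q 2) (cong (ℕ._+ q ℕ./ 2 ℕ.* 2) eq)) ⟩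
      1# + (q ℕ./ 2 ℕ.* 2) ×ᶠ 1#                ≡⟨ cong (1# +_) (×-assocˡ 1# (q ℕ./ 2) 2) ⟨
      1# + (q ℕ./ 2) ×ᶠ (1# + (1# + 0#))
        ≡⟨ cong (λ x → 1# + (q ℕ./ 2) ×ᶠ x) (trans (cong (1# +_) (+-identityʳ 1#)) 2≡0) ⟩
      1# + (q ℕ./ 2) ×ᶠ 0#                      ≡⟨ cong (1# +_) (×-zero (q ℕ./ 2)) ⟩
      1# + 0#                                   ≡⟨ +-identityʳ 1# ⟩
      1#                                        ∎)
      where
      ×-zero : ∀ n → n ×ᶠ 0# ≡ 0#
      ×-zero ℕ.zero    = refl
      ×-zero (ℕ.suc n) = trans (+-identityˡ _) (×-zero n)
    ... | ℕ.suc (ℕ.suc _) | s≤s (s≤s ())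

  -- Linear combinations, elimination and linear dependence

  +ᵥ-identityˡ : ∀ {d} (x : Vec Carrier d) → 0ᵥ +ᵥ x ≡ x
  +ᵥ-identityˡ = Vecₚ.zipWith-identityˡ +-identityˡ

  +ᵥ-identityʳ : ∀ {d} (x : Vec Carrier d) → x +ᵥ 0ᵥ ≡ x
  +ᵥ-identityʳ = Vecₚ.zipWith-identityʳ +-identityʳ

  ·ᵥ-zeroˡ : ∀ {d} (x : Vec Carrier d) → 0# ·ᵥ x ≡ 0ᵥ
  ·ᵥ-zeroˡ []      = refl
  ·ᵥ-zeroˡ (a ∷ x) = cong₂ _∷_ (zeroˡ a) (·ᵥ-zeroˡ x)

  ·ᵥ-identityˡ : ∀ {d} (x : Vec Carrier d) → 1# ·ᵥ x ≡ x
  ·ᵥ-identityˡ []      = refl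
  ·ᵥ-identityˡ (a ∷ x) = cong₂ _∷_ (*-identityˡ a) (·ᵥ-identityˡ x)

  ·ᵥ-distribʳ : ∀ {d} s t (x : Vec Carrier d) → (s + t) ·ᵥ x ≡ s ·ᵥ x +ᵥ t ·ᵥ x
  ·ᵥ-distribʳ s t []      = refl
  ·ᵥ-distribʳ s t (a ∷ x) = cong₂ _∷_ (distribʳ a s t) (·ᵥ-distribʳ s t x)

  ·ᵥ-distribˡ : ∀ {d} t (x y : Vec Carrier d) → t ·ᵥ (x +ᵥ y) ≡ t ·ᵥ x +ᵥ t ·ᵥ y
  ·ᵥ-distribˡ t []      []      = refl
  ·ᵥ-distribˡ t (a ∷ x) (b ∷ y) = cong₂ _∷_ (distribˡ t a b) (·ᵥ-distribˡ t x y)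

  ·ᵥ-assoc : ∀ {d} s t (x : Vec Carrier d) → s ·ᵥ (t ·ᵥ x) ≡ (s * t) ·ᵥ x
  ·ᵥ-assoc s t []      = refl
  ·ᵥ-assoc s t (a ∷ x) = cong₂ _∷_ (sym (*-assoc s t a)) (·ᵥ-assoc s t x)

  +ᵥ-interchange : ∀ {d} (w x y z : Vec Carrier d) → (w +ᵥ x) +ᵥ (y +ᵥ z) ≡ (w +ᵥ y) +ᵥ (x +ᵥ z)
  +ᵥ-interchange [] [] [] [] = refl
  +ᵥ-interchange (a ∷ w) (b ∷ x) (c ∷ y) (e ∷ z) = cong₂ _∷_
    (solve 4 (λ a b c e → (a :+ b) :+ (c :+ e) := (a :+ c) :+ (b :+ e)) refl a b c e)
    (+ᵥ-interchange w x y z)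

  linearCombination-+ : ∀ {d m} (ss ts : Vec Carrier m) (vs : Vec (Vec Carrier d) m) →
    linearCombination (ss +ᵥ ts) vs ≡ linearCombination ss vs +ᵥ linearCombination ts vs
  linearCombination-+ []       []       []       = sym (+ᵥ-identityˡ _)
  linearCombination-+ (s ∷ ss) (t ∷ ts) (v ∷ vs) = begin
    (s + t) ·ᵥ v +ᵥ linearCombination (ss +ᵥ ts) vs
      ≡⟨ cong₂ _+ᵥ_ (·ᵥ-distribʳ s t v) (linearCombination-+ ss ts vs) ⟩
    (s ·ᵥ v +ᵥ t ·ᵥ v) +ᵥ (linearCombination ss vs +ᵥ linearCombination ts vs)
      ≡⟨ +ᵥ-interchange _ _ _ _ ⟩
    (s ·ᵥ v +ᵥ linearCombination ss vs) +ᵥ (t ·ᵥ v +ᵥ linearCombination ts vs) ∎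

  linearCombination-zeroˡ : ∀ {d m} (vs : Vec (Vec Carrier d) m) → linearCombination 0ᵥ vs ≡ 0ᵥ
  linearCombination-zeroˡ []       = refl
  linearCombination-zeroˡ (v ∷ vs) =
    trans (cong₂ _+ᵥ_ (·ᵥ-zeroˡ v) (linearCombination-zeroˡ vs)) (+ᵥ-identityˡ _)

  record IsLinearMap {d e} (f : Vec Carrier d → Vec Carrier e) : Set where
    field
      +-homo : ∀ x y → f (x +ᵥ y) ≡ f x +ᵥ f y
      ·-homo : ∀ t x → f (t ·ᵥ x) ≡ t ·ᵥ f x

    0-homo : f 0ᵥ ≡ 0ᵥ
    0-homo = trans (cong f (sym (·ᵥ-zeroˡ 0ᵥ))) (trans (·-homo 0# 0ᵥ) (·ᵥ-zeroˡ _))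

    linearCombination-homo : ∀ {m} ts (vs : Vec (Vec Carrier d) m) →
      f (linearCombination ts vs) ≡ linearCombination ts (Vec.map f vs)
    linearCombination-homo []       []       = 0-homo
    linearCombination-homo (t ∷ ts) (v ∷ vs) =
      trans (+-homo (t ·ᵥ v) _) (cong₂ _+ᵥ_ (·-homo t v) (linearCombination-homo ts vs))

  LinearlyDependent : ∀ {d m} → Vec (Vec Carrier d) m → Set
  LinearlyDependent vs = ∃[ ts ] ts ≢ 0ᵥ × linearCombination ts vs ≡ 0ᵥ

  vanishing? : ∀ {d} (x : Vec Carrier d) → x ≡ 0ᵥ ⊎ ∃[ j ] lookup x j ≢ 0#
  vanishing? []      = inj₁ refl
  vanishing? (a ∷ x) with a ≟ 0# | vanishing? x
  ... | no a≢0   | _               = inj₂ (zero , a≢0)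
  ... | yes _    | inj₂ (j , x≢0)  = inj₂ (suc j , x≢0)
  ... | yes refl | inj₁ refl       = inj₁ refl

  removeAt-linear : ∀ {d} (j : Fin (suc d)) → IsLinearMap {suc d} (λ x → removeAt x j)
  removeAt-linear j = record { +-homo = +-homo j ; ·-homo = ·-homo j }
    where
    +-homo : ∀ {d} j (x y : Vec Carrier (suc d)) → removeAt (x +ᵥ y) j ≡ removeAt x j +ᵥ removeAt y j
    +-homo zero    (a ∷ x)          (b ∷ y)          = refl
    +-homo (suc j) (a ∷ x@(_ ∷ _))  (b ∷ y@(_ ∷ _))  = cong (a + b ∷_) (+-homo j x y)
    ·-homo : ∀ {d} j t (x : Vec Carrier (suc d)) → removeAt (t ·ᵥ x) j ≡ t ·ᵥ removeAt x j
    ·-homo zero    t (a ∷ x)         = refl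
    ·-homo (suc j) t (a ∷ x@(_ ∷ _)) = cong (t * a ∷_) (·-homo j t x)

  removeAt≡0 : ∀ {d} (x : Vec Carrier (suc d)) j → lookup x j ≡ 0# → removeAt x j ≡ 0ᵥ → x ≡ 0ᵥ
  removeAt≡0 (a ∷ x)         zero    a≡0 x≡0 = cong₂ _∷_ a≡0 x≡0
  removeAt≡0 (a ∷ x@(_ ∷ _)) (suc j) x≡0 ax≡0 =
    cong₂ _∷_ (proj₁ (Vecₚ.∷-injective ax≡0)) (removeAt≡0 x j x≡0 (proj₂ (Vecₚ.∷-injective ax≡0)))

  -- Adding multiples of `v` to the other vectors only changes the coefficient of `v`, which
  -- collects to the sum of the products of `ts` with the multipliers. A relation found after a
  -- pivot step thus lifts to the original vectors with the same `ts`.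
  eliminate : ∀ {d m} (v : Vec Carrier d) (c : Vec Carrier d → Carrier) ts (vs : Vec (Vec Carrier d) m) →
    ∃[ t ] linearCombination ts (Vec.map (λ w → c w ·ᵥ v +ᵥ w) vs) ≡ linearCombination (t ∷ ts) (v ∷ vs)
  eliminate v c []       []       = 0# , sym (trans (+ᵥ-identityʳ _) (·ᵥ-zeroˡ v))
  eliminate v c (t ∷ ts) (w ∷ ws) with s , eq ← eliminate v c ts ws =
    t * c w + s , (begin
      t ·ᵥ (c w ·ᵥ v +ᵥ w) +ᵥ linearCombination ts (Vec.map _ ws)
        ≡⟨ cong₂ _+ᵥ_ (trans (·ᵥ-distribˡ t _ w) (cong (_+ᵥ t ·ᵥ w) (·ᵥ-assoc t (c w) v))) eq ⟩
      ((t * c w) ·ᵥ v +ᵥ t ·ᵥ w) +ᵥ (s ·ᵥ v +ᵥ linearCombination ts ws)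
        ≡⟨ +ᵥ-interchange _ _ _ _ ⟩
      ((t * c w) ·ᵥ v +ᵥ s ·ᵥ v) +ᵥ (t ·ᵥ w +ᵥ linearCombination ts ws)
        ≡⟨ cong (_+ᵥ (t ·ᵥ w +ᵥ linearCombination ts ws)) (·ᵥ-distribʳ (t * c w) s v) ⟨
      (t * c w + s) ·ᵥ v +ᵥ (t ·ᵥ w +ᵥ linearCombination ts ws) ∎)

  lookup-linearCombination≡0 : ∀ {d m} (j : Fin d) ts (vs : Vec (Vec Carrier d) m) →
    (∀ i → lookup (lookup vs i) j ≡ 0#) → lookup (linearCombination ts vs) j ≡ 0#
  lookup-linearCombination≡0 j []       []       _    = Vecₚ.lookup-replicate j 0#
  lookup-linearCombination≡0 j (t ∷ ts) (v ∷ vs) vs≡0 = begin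
    lookup (t ·ᵥ v +ᵥ linearCombination ts vs) j
      ≡⟨ Vecₚ.lookup-zipWith _+_ j (t ·ᵥ v) (linearCombination ts vs) ⟩
    lookup (t ·ᵥ v) j + lookup (linearCombination ts vs) j
      ≡⟨ cong₂ _+_ (trans (Vecₚ.lookup-map j (t *_) v) (trans (cong (t *_) (vs≡0 zero)) (zeroʳ t)))
                   (lookup-linearCombination≡0 j ts vs (vs≡0 ∘ suc)) ⟩
    0# + 0#
      ≡⟨ +-identityˡ 0# ⟩
    0# ∎

  coefficient : ∀ {d} → Vec Carrier d → Fin d → Vec Carrier d → Carrier
  coefficient v j w = - (lookup w j * lookup v j ⁻¹)

  coefficient-eliminates : ∀ {d} (v : Vec Carrier d) j → lookup v j ≢ 0# →
    ∀ w → lookup (coefficient v j w ·ᵥ v +ᵥ w) j ≡ 0#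
  coefficient-eliminates v j vⱼ≢0 w = begin
    lookup (c ·ᵥ v +ᵥ w) j              ≡⟨ Vecₚ.lookup-zipWith _+_ j (c ·ᵥ v) w ⟩
    lookup (c ·ᵥ v) j + wⱼ              ≡⟨ cong (_+ wⱼ) (Vecₚ.lookup-map j (c *_) v) ⟩
    - (wⱼ * vⱼ ⁻¹) * vⱼ + wⱼ            ≡⟨ cong (_+ wⱼ) (-‿distribˡ-* (wⱼ * vⱼ ⁻¹) vⱼ) ⟨
    - (wⱼ * vⱼ ⁻¹ * vⱼ) + wⱼ
      ≡⟨ cong (λ x → - x + wⱼ) (solve 3 (λ w i v → w :* i :* v := w :* (v :* i)) refl wⱼ (vⱼ ⁻¹) vⱼ) ⟩
    - (wⱼ * (vⱼ * vⱼ ⁻¹)) + wⱼ          ≡⟨ cong (λ x → - (wⱼ * x) + wⱼ) (*-inverseʳ vⱼ vⱼ≢0) ⟩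
    - (wⱼ * 1#) + wⱼ                    ≡⟨ cong (λ x → - x + wⱼ) (*-identityʳ wⱼ) ⟩
    - wⱼ + wⱼ                           ≡⟨ -‿inverseˡ wⱼ ⟩
    0#                                  ∎
    where
    vⱼ = lookup v j
    wⱼ = lookup w j
    c = coefficient v j w

  -- Gaussian elimination, by induction on the dimension: a vanishing first vector is a relation by
  -- itself; otherwise a nonzero coordinate of it is cleared from the other vectors and deleted,
  -- which lowers dimension and number of vectors by one. In dimension 0 only the vanishing case can
  -- occur. The lifted relation is nontrivial because its tail is.
  dependent : ∀ {d m} → d ℕ.≤ m → (vs : Vec (Vec Carrier d) (suc m)) → LinearlyDependent vs
  dependent d≤m (v ∷ vs) with vanishing? v
  dependent d≤m (v ∷ vs) | inj₁ refl = 1# ∷ 0ᵥ , (λ eq → 0≢1 (sym (cong Vec.head eq))) , (begin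
    1# ·ᵥ 0ᵥ +ᵥ linearCombination 0ᵥ vs   ≡⟨ cong₂ _+ᵥ_ (·ᵥ-identityˡ 0ᵥ) (linearCombination-zeroˡ vs) ⟩
    0ᵥ +ᵥ 0ᵥ                              ≡⟨ +ᵥ-identityˡ 0ᵥ ⟩
    0ᵥ                                    ∎)
  dependent {suc d} {suc m} (s≤s d≤m) (v ∷ vs) | inj₂ (j , vⱼ≢0)
    with ts , ts≢0 , eq ← dependent d≤m
           (Vec.map (λ w → removeAt w j) (Vec.map (λ w → coefficient v j w ·ᵥ v +ᵥ w) vs))
    with t , lc≡ ← eliminate v (coefficient v j) ts vs
    = t ∷ ts , (ts≢0 ∘ cong Vec.tail) , trans (sym lc≡) (removeAt≡0 _ j
        (lookup-linearCombination≡0 j ts _ λ i →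
          trans (cong (λ w → lookup w j) (Vecₚ.lookup-map i _ vs)) (coefficient-eliminates v j vⱼ≢0 (lookup vs i)))
        (trans (IsLinearMap.linearCombination-homo (removeAt-linear j) ts _) eq))

-- The split form on F⁴

module HyperbolicForm {q} (F : FiniteField q) where
  open FiniteField F
  open FieldProperties F
  open SemiringSolver (CommutativeRing.commutativeSemiring commutativeRing) using (solve; _:+_; _:*_; _:=_)
  open ≡-Reasoning

  hyperbolic : Point F 4 → Carrier
  hyperbolic (x₁ ∷ x₂ ∷ y₁ ∷ y₂ ∷ []) = x₁ * y₁ + x₂ * y₂

  -- The polarisation Q(x + y) - Q(x) - Q(y), expanded so that no subtraction remains: its
  -- identities then fall to the semiring solver, and `half-difference` ties it to the bilinear
  -- form.
  polar : Point F 4 → Point F 4 → Carrier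
  polar (x₁ ∷ x₂ ∷ y₁ ∷ y₂ ∷ []) (x₁′ ∷ x₂′ ∷ y₁′ ∷ y₂′ ∷ []) =
    (x₁ * y₁′ + x₂ * y₂′) + (x₁′ * y₁ + x₂′ * y₂)

  hyperbolic-+ : ∀ x y → hyperbolic (x +ᵥ y) ≡ hyperbolic x + (hyperbolic y + polar x y)
  hyperbolic-+ (a ∷ b ∷ c ∷ e ∷ []) (a′ ∷ b′ ∷ c′ ∷ e′ ∷ []) =
    solve 8 (λ a b c e a′ b′ c′ e′ →
      (a :+ a′) :* (c :+ c′) :+ (b :+ b′) :* (e :+ e′) :=
      (a :* c :+ b :* e) :+ ((a′ :* c′ :+ b′ :* e′) :+ ((a :* c′ :+ b :* e′) :+ (a′ :* c :+ b′ :* e))))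
      refl a b c e a′ b′ c′ e′

  polar-additiveˡ : ∀ x y z → polar (x +ᵥ y) z ≡ polar x z + polar y z
  polar-additiveˡ (a ∷ b ∷ c ∷ e ∷ []) (a′ ∷ b′ ∷ c′ ∷ e′ ∷ []) (a″ ∷ b″ ∷ c″ ∷ e″ ∷ []) =
    solve 12 (λ a b c e a′ b′ c′ e′ a″ b″ c″ e″ →
      ((a :+ a′) :* c″ :+ (b :+ b′) :* e″) :+ (a″ :* (c :+ c′) :+ b″ :* (e :+ e′)) :=
      ((a :* c″ :+ b :* e″) :+ (a″ :* c :+ b″ :* e)) :+
      ((a′ :* c″ :+ b′ :* e″) :+ (a″ :* c′ :+ b″ :* e′)))
      refl a b c e a′ b′ c′ e′ a″ b″ c″ e″

  polar-homogeneousˡ : ∀ t x y → polar (t ·ᵥ x) y ≡ t * polar x y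
  polar-homogeneousˡ t (a ∷ b ∷ c ∷ e ∷ []) (a′ ∷ b′ ∷ c′ ∷ e′ ∷ []) =
    solve 9 (λ t a b c e a′ b′ c′ e′ →
      (t :* a :* c′ :+ t :* b :* e′) :+ (a′ :* (t :* c) :+ b′ :* (t :* e)) :=
      t :* ((a :* c′ :+ b :* e′) :+ (a′ :* c :+ b′ :* e)))
      refl t a b c e a′ b′ c′ e′

  half-difference : ∀ x y → (hyperbolic (x +ᵥ y) - hyperbolic x - hyperbolic y) * 2# ⁻¹ ≡ polar x y * 2# ⁻¹
  half-difference x y = cong (_* 2# ⁻¹) (begin
    hyperbolic (x +ᵥ y) - hyperbolic x - hyperbolic y
      ≡⟨ cong (λ z → z - hyperbolic x - hyperbolic y) (hyperbolic-+ x y) ⟩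
    hyperbolic x + (hyperbolic y + polar x y) - hyperbolic x - hyperbolic y
      ≡⟨ cong (_- hyperbolic y) (x+y-x≡y (hyperbolic x) _) ⟩
    hyperbolic y + polar x y - hyperbolic y
      ≡⟨ x+y-x≡y (hyperbolic y) _ ⟩
    polar x y ∎)

  hyperbolicForm : QuadraticForm F 4
  hyperbolicForm = record
    { form             = hyperbolic
    ; form-homogeneous = homogeneous
    ; ⟨⟩-additiveˡ     = λ x y z → begin
        _                                        ≡⟨ half-difference (x +ᵥ y) z ⟩
        polar (x +ᵥ y) z * 2# ⁻¹                 ≡⟨ cong (_* 2# ⁻¹) (polar-additiveˡ x y z) ⟩
        (polar x z + polar y z) * 2# ⁻¹          ≡⟨ distribʳ _ _ _ ⟩
        polar x z * 2# ⁻¹ + polar y z * 2# ⁻¹    ≡⟨ cong₂ _+_ (half-difference x z) (half-difference y z) ⟨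
        _                                        ∎
    ; ⟨⟩-homogeneousˡ  = λ t x y → begin
        _                             ≡⟨ half-difference (t ·ᵥ x) y ⟩
        polar (t ·ᵥ x) y * 2# ⁻¹      ≡⟨ cong (_* 2# ⁻¹) (polar-homogeneousˡ t x y) ⟩
        t * polar x y * 2# ⁻¹         ≡⟨ *-assoc _ _ _ ⟩
        t * (polar x y * 2# ⁻¹)       ≡⟨ cong (t *_) (half-difference x y) ⟨
        _                             ∎
    }
    where
    homogeneous : ∀ t x → hyperbolic (t ·ᵥ x) ≡ (t * t) * hyperbolic x
    homogeneous t (a ∷ b ∷ c ∷ e ∷ []) = solve 5 (λ t a b c e →
      t :* a :* (t :* c) :+ t :* b :* (t :* e) := t :* t :* (a :* c :+ b :* e)) refl t a b c e

  -- The two isotropic halves, nondegeneracy and the Witt index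

  upper lower : Point F 4 → Vec Carrier 2
  upper (x₁ ∷ x₂ ∷ y₁ ∷ y₂ ∷ []) = x₁ ∷ x₂ ∷ []
  lower (x₁ ∷ x₂ ∷ y₁ ∷ y₂ ∷ []) = y₁ ∷ y₂ ∷ []

  upper-linear : IsLinearMap upper
  upper-linear = record
    { +-homo = λ { (_ ∷ _ ∷ _ ∷ _ ∷ []) (_ ∷ _ ∷ _ ∷ _ ∷ []) → refl }
    ; ·-homo = λ { _ (_ ∷ _ ∷ _ ∷ _ ∷ []) → refl } }

  lower-linear : IsLinearMap lower
  lower-linear = record
    { +-homo = λ { (_ ∷ _ ∷ _ ∷ _ ∷ []) (_ ∷ _ ∷ _ ∷ _ ∷ []) → refl }
    ; ·-homo = λ { _ (_ ∷ _ ∷ _ ∷ _ ∷ []) → refl } }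

  upper≡0∧lower≡0⇒≡0 : ∀ x → upper x ≡ 0ᵥ → lower x ≡ 0ᵥ → x ≡ 0ᵥ
  upper≡0∧lower≡0⇒≡0 (_ ∷ _ ∷ _ ∷ _ ∷ []) refl refl = refl

  infix 7 _∙_
  _∙_ : Vec Carrier 2 → Vec Carrier 2 → Carrier
  (a ∷ b ∷ []) ∙ (c ∷ e ∷ []) = a * c + b * e

  ∙-zeroˡ : ∀ x → 0ᵥ ∙ x ≡ 0#
  ∙-zeroˡ (a ∷ b ∷ []) = trans (cong₂ _+_ (zeroˡ a) (zeroˡ b)) (+-identityˡ 0#)

  ∙-zeroʳ : ∀ x → x ∙ 0ᵥ ≡ 0#
  ∙-zeroʳ (a ∷ b ∷ []) = trans (cong₂ _+_ (zeroʳ a) (zeroʳ b)) (+-identityˡ 0#)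

  ∙-comm : ∀ x y → x ∙ y ≡ y ∙ x
  ∙-comm (a ∷ b ∷ []) (c ∷ e ∷ []) = cong₂ _+_ (*-comm a c) (*-comm b e)

  hyperbolic-∙ : ∀ x → hyperbolic x ≡ upper x ∙ lower x
  hyperbolic-∙ (_ ∷ _ ∷ _ ∷ _ ∷ []) = refl

  polar-∙ : ∀ x y → polar x y ≡ upper x ∙ lower y + upper y ∙ lower x
  polar-∙ (_ ∷ _ ∷ _ ∷ _ ∷ []) (_ ∷ _ ∷ _ ∷ _ ∷ []) = refl

  unit∙ : ∀ x y → (1# ∷ 0# ∷ []) ∙ (x ∷ y ∷ []) ≡ x
  unit∙ x y = trans (cong₂ _+_ (*-identityˡ x) (zeroˡ y)) (+-identityʳ x)

  unit∙′ : ∀ x y → (0# ∷ 1# ∷ []) ∙ (x ∷ y ∷ []) ≡ y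
  unit∙′ x y = trans (cong₂ _+_ (zeroˡ x) (*-identityˡ y)) (+-identityˡ y)

  ∙-nondegenerate : ∀ x → (∀ y → y ∙ x ≡ 0#) → x ≡ 0ᵥ
  ∙-nondegenerate (a ∷ b ∷ []) x⊥ = cong₂ (λ s t → s ∷ t ∷ [])
    (trans (sym (unit∙ a b)) (x⊥ (1# ∷ 0# ∷ []))) (trans (sym (unit∙′ a b)) (x⊥ (0# ∷ 1# ∷ [])))

  -- The polar form pairs each half with the opposite one, so test vectors supported on one half
  -- detect the other half of `x`. The assumption `2# ≢ 0#` lets the factor `2# ⁻¹` be cancelled.
  nondegenerate : 2# ≢ 0# → Nondegenerate hyperbolicForm
  nondegenerate 2≢0 x x⊥ = upper≡0∧lower≡0⇒≡0 x
    (∙-nondegenerate (upper x) λ { y@(a ∷ b ∷ []) → begin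
      y ∙ upper x                                      ≡⟨ ∙-comm y (upper x) ⟩
      upper x ∙ y                                      ≡⟨ +-identityʳ _ ⟨
      upper x ∙ y + 0#                                 ≡⟨ cong (upper x ∙ y +_) (∙-zeroˡ (lower x)) ⟨
      upper x ∙ y + 0ᵥ ∙ lower x                       ≡⟨ polar-∙ x (0# ∷ 0# ∷ y) ⟨
      polar x (0# ∷ 0# ∷ y)                            ≡⟨ polar⊥ (0# ∷ 0# ∷ y) ⟩
      0#                                               ∎ })
    (∙-nondegenerate (lower x) λ { y@(a ∷ b ∷ []) → begin
      y ∙ lower x                                      ≡⟨ +-identityˡ _ ⟨
      0# + y ∙ lower x                                 ≡⟨ cong (_+ y ∙ lower x) (∙-zeroʳ (upper x)) ⟨
      upper x ∙ 0ᵥ + y ∙ lower x                       ≡⟨ polar-∙ x (a ∷ b ∷ 0ᵥ) ⟨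
      polar x (a ∷ b ∷ 0ᵥ)                             ≡⟨ polar⊥ (a ∷ b ∷ 0ᵥ) ⟩
      0#                                               ∎ })
    where
    polar⊥ : ∀ y → polar x y ≡ 0#
    polar⊥ y = x*y≡0⇒x≡0 (⁻¹-≢0 2≢0) (trans (sym (half-difference x y)) (x⊥ y))

  isotropicBasis : ∃[ vs ] TotallyIsotropicBasis hyperbolicForm {2} vs
  isotropicBasis = vs , (λ { ts@(_ ∷ _ ∷ []) eq → trans (sym (upper-combination ts)) (cong upper eq) })
    , λ ts → let x = linearCombination ts vs in
      trans (hyperbolic-∙ x) (trans (cong (upper x ∙_) (lower-combination ts)) (∙-zeroʳ (upper x)))
    where
    vs : Vec (Point F 4) 2
    vs = (1# ∷ 0# ∷ 0# ∷ 0# ∷ []) ∷ (0# ∷ 1# ∷ 0# ∷ 0# ∷ []) ∷ []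
    upper-combination : ∀ ts → upper (linearCombination ts vs) ≡ ts
    upper-combination (s ∷ t ∷ []) = cong₂ (λ a b → a ∷ b ∷ [])
      (trans (cong (s * 1# +_) (+-identityʳ (t * 0#))) (trans (cong₂ _+_ (*-identityʳ s) (zeroʳ t)) (+-identityʳ s)))
      (trans (cong (s * 0# +_) (+-identityʳ (t * 1#))) (trans (cong₂ _+_ (zeroʳ s) (*-identityʳ t)) (+-identityˡ t)))
    lower-combination : ∀ ts → lower (linearCombination ts vs) ≡ 0ᵥ
    lower-combination (s ∷ t ∷ []) = cong (λ a → a ∷ a ∷ [])
      (trans (cong₂ _+_ (zeroʳ s) (trans (+-identityʳ _) (zeroʳ t))) (+-identityˡ 0#))

  -- The orthogonal complement of a nonzero vector in F² is a line, on which one coordinate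
  -- determines the point: the coordinate other than the one where `x` was found to be nonzero.
  ⊥-coordinate : ∀ x → x ≢ 0ᵥ → ∃[ i ] (∀ y → x ∙ y ≡ 0# → lookup y i ≡ 0# → y ≡ 0ᵥ)
  ⊥-coordinate (a ∷ b ∷ []) x≢0 with a ≟ 0# | b ≟ 0#
  ... | no a≢0 | _ = suc zero , λ { (c ∷ e ∷ []) x⊥y refl → cong (_∷ 0# ∷ [])
    (x*y≡0⇒y≡0 a≢0 (trans (sym (trans (cong (a * c +_) (zeroʳ b)) (+-identityʳ _))) x⊥y)) }
  ... | yes _ | no b≢0 = zero , λ { (c ∷ e ∷ []) x⊥y refl → cong (λ e → 0# ∷ e ∷ [])
    (x*y≡0⇒y≡0 b≢0 (trans (sym (trans (cong (_+ b * e) (zeroʳ a)) (+-identityˡ _))) x⊥y)) }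
  ... | yes refl | yes refl = contradiction refl x≢0

  coordinates : Fin 2 → Fin 2 → Point F 4 → Vec Carrier 2
  coordinates i j x = lookup (upper x) i ∷ lookup (lower x) j ∷ []

  coordinates-linear : ∀ i j → IsLinearMap (coordinates i j)
  coordinates-linear i j = record
    { +-homo = λ x y → cong₂ (λ a b → a ∷ b ∷ [])
        (trans (cong (λ z → lookup z i) (IsLinearMap.+-homo upper-linear x y))
          (Vecₚ.lookup-zipWith _+_ i (upper x) (upper y)))
        (trans (cong (λ z → lookup z j) (IsLinearMap.+-homo lower-linear x y))
          (Vecₚ.lookup-zipWith _+_ j (lower x) (lower y)))
    ; ·-homo = λ t x → cong₂ (λ a b → a ∷ b ∷ [])
        (trans (cong (λ z → lookup z i) (IsLinearMap.·-homo upper-linear t x))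
          (Vecₚ.lookup-map i (t *_) (upper x)))
        (trans (cong (λ z → lookup z j) (IsLinearMap.·-homo lower-linear t x))
          (Vecₚ.lookup-map j (t *_) (lower x))) }

  upper⊥lower : ∀ x y → polar x y ≡ 0# → lower x ≡ 0ᵥ → upper x ∙ lower y ≡ 0#
  upper⊥lower x y x⊥y lower≡0 = begin
    upper x ∙ lower y                        ≡⟨ +-identityʳ _ ⟨
    upper x ∙ lower y + 0#                   ≡⟨ cong (upper x ∙ lower y +_) (∙-zeroʳ (upper y)) ⟨
    upper x ∙ lower y + upper y ∙ 0ᵥ         ≡⟨ cong (λ z → upper x ∙ lower y + upper y ∙ z) lower≡0 ⟨
    upper x ∙ lower y + upper y ∙ lower x    ≡⟨ polar-∙ x y ⟨
    polar x y                                ≡⟨ x⊥y ⟩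
    0#                                       ∎

  lower⊥upper : ∀ x y → polar x y ≡ 0# → upper x ≡ 0ᵥ → lower x ∙ upper y ≡ 0#
  lower⊥upper x y x⊥y upper≡0 = begin
    lower x ∙ upper y                        ≡⟨ ∙-comm (lower x) (upper y) ⟩
    upper y ∙ lower x                        ≡⟨ +-identityˡ _ ⟨
    0# + upper y ∙ lower x                   ≡⟨ cong (_+ upper y ∙ lower x) (∙-zeroˡ (lower y)) ⟨
    0ᵥ ∙ lower y + upper y ∙ lower x         ≡⟨ cong (λ z → z ∙ lower y + upper y ∙ lower x) upper≡0 ⟨
    upper x ∙ lower y + upper y ∙ lower x    ≡⟨ polar-∙ x y ⟨
    polar x y                                ≡⟨ x⊥y ⟩
    0#                                       ∎

  -- The span is closed under addition, so every term of `hyperbolic-+` other than the polar one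
  -- vanishes.
  isotropic⇒orthogonal : ∀ {m} (vs : Vec (Point F 4) m) → (∀ ts → hyperbolic (linearCombination ts vs) ≡ 0#) →
    ∀ ss ts → polar (linearCombination ss vs) (linearCombination ts vs) ≡ 0#
  isotropic⇒orthogonal vs isotropic ss ts = begin
    polar x y                                       ≡⟨ trans (+-identityˡ _) (+-identityˡ _) ⟨
    0# + (0# + polar x y)
      ≡⟨ cong₂ (λ a b → a + (b + polar x y)) (isotropic ss) (isotropic ts) ⟨
    hyperbolic x + (hyperbolic y + polar x y)       ≡⟨ hyperbolic-+ x y ⟨
    hyperbolic (x +ᵥ y)                             ≡⟨ cong hyperbolic (linearCombination-+ ss ts vs) ⟨
    hyperbolic (linearCombination (ss +ᵥ ts) vs)    ≡⟨ isotropic (ss +ᵥ ts) ⟩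
    0#                                              ∎
    where
    x = linearCombination ss vs
    y = linearCombination ts vs

  module _ {n} (2≤n : 2 ℕ.≤ n) (vs : Vec (Point F 4) (suc n)) where

    -- At least three vectors have dependent images in F², and the coefficients of that dependence
    -- give a combination killed by `f`.
    kernelVector : ∀ {f} → IsLinearMap f → ∃[ ts ] ts ≢ 0ᵥ × f (linearCombination ts vs) ≡ 0ᵥ {2}
    kernelVector {f} f-linear with ts , ts≢0 , eq ← dependent 2≤n (Vec.map f vs) =
      ts , ts≢0 , trans (IsLinearMap.linearCombination-homo f-linear ts vs) eq

    -- A totally isotropic space of dimension > 2 contains nonzero vectors w with lower w = 0 and
    -- w′ with upper w′ = 0. Orthogonality to w and w′ leaves only two free coordinates.
    ¬isotropic : ¬ TotallyIsotropicBasis hyperbolicForm vs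
    ¬isotropic (independent , isotropic)
      with ss , ss≢0 , lower≡0 ← kernelVector lower-linear
         | ts , ts≢0 , upper≡0 ← kernelVector upper-linear
      with j , upper⊥ ← ⊥-coordinate (upper (linearCombination ss vs))
             (λ upper≡0 → ss≢0 (independent ss (upper≡0∧lower≡0⇒≡0 _ upper≡0 lower≡0)))
         | i , lower⊥ ← ⊥-coordinate (lower (linearCombination ts vs))
             (λ lower≡0 → ts≢0 (independent ts (upper≡0∧lower≡0⇒≡0 _ upper≡0 lower≡0)))
      -- Orthogonality confines each half of any combination to a line. One coordinate per half
      -- decides whether it vanishes, and a nontrivial combination can be made to vanish in these
      -- two.
      with us , us≢0 , eq ← kernelVector (coordinates-linear i j) =
      us≢0 (independent us (upper≡0∧lower≡0⇒≡0 _
        (lower⊥ _ (lower⊥upper _ _ (isotropic⇒orthogonal vs isotropic ts us) upper≡0) (cong Vec.head eq))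
        (upper⊥ _ (upper⊥lower _ _ (isotropic⇒orthogonal vs isotropic ss us) lower≡0)
                  (cong (Vec.head ∘ Vec.tail) eq))))

  wittIndex : WittIndex hyperbolicForm 2
  wittIndex = isotropicBasis , λ
    { zero vs _ → z≤n
    ; (suc zero) vs _ → s≤s z≤n
    ; (suc (suc zero)) vs _ → ℕₚ.≤-refl
    ; (suc (suc (suc n))) vs basis → contradiction basis (¬isotropic (s≤s (s≤s z≤n)) vs) }

-- Integers modulo a prime

module ModularArithmetic (p : ℕ) ⦃ _ : NonZero p ⦄ where

  [_] : ℕ → Fin p
  [ n ] = fromℕ< (m%n<n n p)

  toℕ-[] : ∀ n → toℕ [ n ] ≡ n % p
  toℕ-[] n = toℕ-fromℕ< (m%n<n n p)

  []-cong : ∀ {m n} → m % p ≡ n % p → [ m ] ≡ [ n ]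
  []-cong {m} {n} eq = toℕ-injective (trans (toℕ-[] m) (trans eq (sym (toℕ-[] n))))

  []-toℕ : ∀ x → [ toℕ x ] ≡ x
  []-toℕ x = toℕ-injective (trans (toℕ-[] (toℕ x)) (m<n⇒m%n≡m (toℕ<n x)))

  infixl 6 _⊕_
  infixl 7 _⊗_

  _⊕_ _⊗_ : Fin p → Fin p → Fin p
  x ⊕ y = [ toℕ x ℕ.+ toℕ y ]
  x ⊗ y = [ toℕ x ℕ.* toℕ y ]

  ⊖_ : Fin p → Fin p
  ⊖ x = [ p ∸ toℕ x ]

  0%p≡0 : 0 % p ≡ 0
  0%p≡0 = m*n%n≡0 0 p

  []-⊕ : ∀ m n → [ m ] ⊕ [ n ] ≡ [ m ℕ.+ n ]
  []-⊕ m n = []-cong (trans (cong₂ (λ a b → (a ℕ.+ b) % p) (toℕ-[] m) (toℕ-[] n))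
                            (sym (%-distribˡ-+ m n p)))

  []-⊗ : ∀ m n → [ m ] ⊗ [ n ] ≡ [ m ℕ.* n ]
  []-⊗ m n = []-cong (trans (cong₂ (λ a b → (a ℕ.* b) % p) (toℕ-[] m) (toℕ-[] n))
                            (sym (%-distribˡ-* m n p)))

  []-⊕ˡ : ∀ m y → [ m ] ⊕ y ≡ [ m ℕ.+ toℕ y ]
  []-⊕ˡ m y = trans (cong ([ m ] ⊕_) (sym ([]-toℕ y))) ([]-⊕ m (toℕ y))

  []-⊗ˡ : ∀ m y → [ m ] ⊗ y ≡ [ m ℕ.* toℕ y ]
  []-⊗ˡ m y = trans (cong ([ m ] ⊗_) (sym ([]-toℕ y))) ([]-⊗ m (toℕ y))

  ⊕-comm : ∀ x y → x ⊕ y ≡ y ⊕ x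
  ⊕-comm x y = cong [_] (ℕₚ.+-comm (toℕ x) (toℕ y))

  ⊗-comm : ∀ x y → x ⊗ y ≡ y ⊗ x
  ⊗-comm x y = cong [_] (ℕₚ.*-comm (toℕ x) (toℕ y))

  ⊕-assoc : ∀ x y z → (x ⊕ y) ⊕ z ≡ x ⊕ (y ⊕ z)
  ⊕-assoc x y z = begin
    (x ⊕ y) ⊕ z                      ≡⟨ []-⊕ˡ (toℕ x ℕ.+ toℕ y) z ⟩
    [ toℕ x ℕ.+ toℕ y ℕ.+ toℕ z ]
      ≡⟨ cong [_] (trans (ℕₚ.+-assoc (toℕ x) (toℕ y) (toℕ z)) (ℕₚ.+-comm (toℕ x) _)) ⟩
    -- `[]-⊕ˡ` removes a reduction in the left operand, hence the commutations around this step.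
    [ toℕ y ℕ.+ toℕ z ℕ.+ toℕ x ]    ≡⟨ []-⊕ˡ (toℕ y ℕ.+ toℕ z) x ⟨
    (y ⊕ z) ⊕ x                      ≡⟨ ⊕-comm (y ⊕ z) x ⟩
    x ⊕ (y ⊕ z)                      ∎
    where open ≡-Reasoning

  ⊗-assoc : ∀ x y z → (x ⊗ y) ⊗ z ≡ x ⊗ (y ⊗ z)
  ⊗-assoc x y z = begin
    (x ⊗ y) ⊗ z                      ≡⟨ []-⊗ˡ (toℕ x ℕ.* toℕ y) z ⟩
    [ toℕ x ℕ.* toℕ y ℕ.* toℕ z ]
      ≡⟨ cong [_] (trans (ℕₚ.*-assoc (toℕ x) (toℕ y) (toℕ z)) (ℕₚ.*-comm (toℕ x) _)) ⟩
    [ toℕ y ℕ.* toℕ z ℕ.* toℕ x ]    ≡⟨ []-⊗ˡ (toℕ y ℕ.* toℕ z) x ⟨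
    (y ⊗ z) ⊗ x                      ≡⟨ ⊗-comm (y ⊗ z) x ⟩
    x ⊗ (y ⊗ z)                      ∎
    where open ≡-Reasoning

  ⊗-distribʳ-⊕ : ∀ x y z → (y ⊕ z) ⊗ x ≡ y ⊗ x ⊕ z ⊗ x
  ⊗-distribʳ-⊕ x y z = begin
    (y ⊕ z) ⊗ x                                  ≡⟨ []-⊗ˡ (toℕ y ℕ.+ toℕ z) x ⟩
    [ (toℕ y ℕ.+ toℕ z) ℕ.* toℕ x ]              ≡⟨ cong [_] (ℕₚ.*-distribʳ-+ (toℕ x) (toℕ y) (toℕ z)) ⟩
    [ toℕ y ℕ.* toℕ x ℕ.+ toℕ z ℕ.* toℕ x ]      ≡⟨ []-⊕ (toℕ y ℕ.* toℕ x) (toℕ z ℕ.* toℕ x) ⟨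
    y ⊗ x ⊕ z ⊗ x                                ∎
    where open ≡-Reasoning

  ⊗-distribˡ-⊕ : ∀ x y z → x ⊗ (y ⊕ z) ≡ x ⊗ y ⊕ x ⊗ z
  ⊗-distribˡ-⊕ x y z = trans (⊗-comm x (y ⊕ z))
    (trans (⊗-distribʳ-⊕ x y z) (cong₂ _⊕_ (⊗-comm y x) (⊗-comm z x)))

  ⊕-identityˡ : ∀ x → [ 0 ] ⊕ x ≡ x
  ⊕-identityˡ x = trans ([]-⊕ˡ 0 x) ([]-toℕ x)

  ⊗-identityˡ : ∀ x → [ 1 ] ⊗ x ≡ x
  ⊗-identityˡ x = trans ([]-⊗ˡ 1 x) (trans (cong [_] (ℕₚ.*-identityˡ (toℕ x))) ([]-toℕ x))

  ⊖-inverseˡ : ∀ x → (⊖ x) ⊕ x ≡ [ 0 ]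
  ⊖-inverseˡ x = begin
    (⊖ x) ⊕ x                     ≡⟨ []-⊕ˡ (p ∸ toℕ x) x ⟩
    [ p ∸ toℕ x ℕ.+ toℕ x ]       ≡⟨ cong [_] (ℕₚ.m∸n+n≡m (ℕₚ.<⇒≤ (toℕ<n x))) ⟩
    [ p ]                         ≡⟨ []-cong (trans (n%n≡0 p) (sym 0%p≡0)) ⟩
    [ 0 ]                         ∎
    where open ≡-Reasoning

  ⊕-⊗-isCommutativeRing : IsCommutativeRing _≡_ _⊕_ _⊗_ ⊖_ [ 0 ] [ 1 ]
  ⊕-⊗-isCommutativeRing = record
    { isRing = record
      { +-isAbelianGroup = record
        { isGroup = record
          { isMonoid = record
            { isSemigroup = record
              { isMagma = record { isEquivalence = isEquivalence ; ∙-cong = cong₂ _⊕_ }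
              ; assoc   = ⊕-assoc }
            ; identity = ⊕-identityˡ , λ x → trans (⊕-comm x [ 0 ]) (⊕-identityˡ x) }
          ; inverse = ⊖-inverseˡ , λ x → trans (⊕-comm x (⊖ x)) (⊖-inverseˡ x)
          ; ⁻¹-cong = cong ⊖_ }
        ; comm = ⊕-comm }
      ; *-cong     = cong₂ _⊗_
      ; *-assoc    = ⊗-assoc
      ; *-identity = ⊗-identityˡ , λ x → trans (⊗-comm x [ 1 ]) (⊗-identityˡ x)
      ; distrib    = ⊗-distribˡ-⊕ , ⊗-distribʳ-⊕ }
    ; *-comm = ⊗-comm }

  module _ (isPrime : Prime p) where
    private
      ring : Ring _ _
      ring = record { isRing = IsCommutativeRing.isRing ⊕-⊗-isCommutativeRing }

    [multiple]≡0 : ∀ a → [ a ℕ.* p ] ≡ [ 0 ]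
    [multiple]≡0 a = []-cong (trans (m*n%n≡0 a p) (sym 0%p≡0))

    -- Bézout's identity over the natural numbers has two sign cases: 1 + a p = b x makes `[ b ]`
    -- the inverse, while 1 + b x = a p makes it `⊖ [ b ]`.
    ⊗-inverse : ∀ x → x ≢ [ 0 ] → ∃[ y ] x ⊗ y ≡ [ 1 ]
    ⊗-inverse x x≢0 with coprime-Bézout (prime⇒coprime isPrime ⦃ x-nonZero ⦄ (toℕ<n x))
      where
      x-nonZero : NonZero (toℕ x)
      x-nonZero = ℕ.≢-nonZero λ eq → x≢0 (trans (sym ([]-toℕ x)) (cong [_] eq))
    ... | Bézout.-+ a b eq = [ b ] , (begin
      x ⊗ [ b ]              ≡⟨ ⊗-comm x [ b ] ⟩
      [ b ] ⊗ x              ≡⟨ []-⊗ˡ b x ⟩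
      [ b ℕ.* toℕ x ]        ≡⟨ cong [_] eq ⟨
      [ 1 ℕ.+ a ℕ.* p ]      ≡⟨ []-⊕ 1 (a ℕ.* p) ⟨
      [ 1 ] ⊕ [ a ℕ.* p ]    ≡⟨ cong ([ 1 ] ⊕_) ([multiple]≡0 a) ⟩
      [ 1 ] ⊕ [ 0 ]          ≡⟨ []-⊕ 1 0 ⟩
      [ 1 ]                  ∎)
      where open ≡-Reasoning
    ... | Bézout.+- a b eq = ⊖ [ b ] , (begin
      x ⊗ (⊖ [ b ])          ≡⟨ -‿distribʳ-* x [ b ] ⟨
      ⊖ (x ⊗ [ b ])          ≡⟨ inverseˡ-unique [ 1 ] (x ⊗ [ b ]) 1+xb≡0 ⟨
      [ 1 ]                  ∎)
      where
      open ≡-Reasoning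
      open RingProperties ring using (-‿distribʳ-*)
      open GroupProperties (Ring.+-group ring) using (inverseˡ-unique)
      1+xb≡0 : [ 1 ] ⊕ x ⊗ [ b ] ≡ [ 0 ]
      1+xb≡0 = begin
        [ 1 ] ⊕ x ⊗ [ b ]           ≡⟨ cong ([ 1 ] ⊕_) (trans (⊗-comm x [ b ]) ([]-⊗ˡ b x)) ⟩
        [ 1 ] ⊕ [ b ℕ.* toℕ x ]     ≡⟨ []-⊕ 1 (b ℕ.* toℕ x) ⟩
        [ 1 ℕ.+ b ℕ.* toℕ x ]       ≡⟨ cong [_] eq ⟩
        [ a ℕ.* p ]                 ≡⟨ [multiple]≡0 a ⟩
        [ 0 ]                       ∎

    inverse : Fin p → Fin p
    inverse x with x ≟ᶠ [ 0 ]
    -- An arbitrary default; `FiniteField` does not constrain the inverse of zero.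
    ... | yes _   = [ 0 ]
    ... | no x≢0  = proj₁ (⊗-inverse x x≢0)

    inverseʳ : ∀ x → x ≢ [ 0 ] → x ⊗ inverse x ≡ [ 1 ]
    inverseʳ x x≢0 with x ≟ᶠ [ 0 ]
    ... | yes x≡0 = contradiction x≡0 x≢0
    ... | no x≢0′ = proj₂ (⊗-inverse x x≢0′)

    field-mod : FiniteField p
    field-mod = record
      { Carrier           = Fin p
      ; _+_               = _⊕_
      ; _*_               = _⊗_
      ; -_                = ⊖_
      ; 0#                = [ 0 ]
      ; 1#                = [ 1 ]
      ; isCommutativeRing = ⊕-⊗-isCommutativeRing
      ; 0≢1               = 0≢1
      ; _⁻¹               = inverse
      ; *-inverseʳ        = inverseʳ
      ; enumeration       = ↔-id (Fin p)
      }
      where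
      1<p : 1 ℕ.< p
      1<p = ℕ.nonTrivial⇒n>1 p ⦃ prime⇒nonTrivial isPrime ⦄
      0≢1 : [ 0 ] ≢ [ 1 ]
      0≢1 eq = ℕₚ.0≢1+n (begin
        0           ≡⟨ m<n⇒m%n≡m (ℕₚ.<-trans ℕₚ.0<1+n 1<p) ⟨
        0 % p       ≡⟨ toℕ-[] 0 ⟨
        toℕ [ 0 ]   ≡⟨ cong toℕ eq ⟩
        toℕ [ 1 ]   ≡⟨ toℕ-[] 1 ⟩
        1 % p       ≡⟨ m<n⇒m%n≡m 1<p ⟩
        1           ∎)
        where open ≡-Reasoning

-- Arbitrarily large primes

prime-divisor : ∀ n → 1 ℕ.< n → ∃[ p ] Prime p × p ∣ n
prime-divisor n 1<n with factorise n ⦃ ℕ.>-nonZero (ℕₚ.<-trans ℕₚ.0<1+n 1<n) ⦄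
... | record { factors = [] ; isFactorisation = eq } = contradiction (sym eq) (ℕₚ.<⇒≢ 1<n)
... | record { factors = p ∷ ps ; isFactorisation = eq ; factorsPrime = isPrime ∷ _ } =
  p , isPrime , subst (p ∣_) (sym eq) (m∣m*n _)

-- Euclid's argument: a prime divisor of 1 + n! that is at most n divides n! as well, hence divides
-- 1.
prime-above : ∀ n → ∃[ p ] Prime p × n ℕ.< p
prime-above n with prime-divisor (1 ℕ.+ n !) (ℕ.s≤s (ℕₚ.1≤n! n))
... | p , isPrime , p∣1+n! = p , isPrime , ℕₚ.≰⇒> λ p≤n → ¬prime[1] (subst Prime
  (∣1⇒≡1 (∣m+n∣m⇒∣n (subst (p ∣_) (ℕₚ.+-comm 1 (n !)) p∣1+n!) (∣-trans (p∣p! p isPrime) (m≤n⇒m!∣n! p≤n)))) isPrime)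
  where
  p∣p! : ∀ p → Prime p → p ∣ p !
  p∣p! ℕ.zero isPrime = contradiction (prime⇒nonZero isPrime) λ ()
  p∣p! (ℕ.suc p) _  = m∣m*n (p !)

primes-odd : ∀ {p} → Prime p → 2 ℕ.< p → ¬ (2 ∣ p)
primes-odd {p} isPrime 2<p 2∣p with prime⇒irreducible isPrime 2∣p
... | inj₂ 2≡p = ℕₚ.<⇒≢ 2<p 2≡p

-- Fractions

open import Data.Integer.Base as ℤ using (+_; -[1+_])

-- `_/_` reduces to lowest terms, so the comparison is made on unnormalised rationals, where the
-- order is cross-multiplication by definition.
/-mono-≤ : ∀ a b c d .⦃ _ : NonZero b ⦄ .⦃ _ : NonZero d ⦄ →
           a ℕ.* d ℕ.≤ c ℕ.* b → + a / b ℚ.≤ + c / d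
/-mono-≤ a b@(suc b-1) c d@(suc d-1) ad≤cb = ℚₚ.toℚᵘ-cancel-≤ (begin
  toℚᵘ (+ a / b)    ≃⟨ ℚₚ.toℚᵘ-fromℚᵘ (mkℚᵘ (+ a) b-1) ⟩
  mkℚᵘ (+ a) b-1    ≤⟨ ℚᵘ.*≤* (subst₂ ℤ._≤_ (ℤₚ.pos-* a d) (ℤₚ.pos-* c b) (ℤ.+≤+ ad≤cb)) ⟩
  mkℚᵘ (+ c) d-1    ≃⟨ ℚₚ.toℚᵘ-fromℚᵘ (mkℚᵘ (+ c) d-1) ⟨
  toℚᵘ (+ c / d)    ∎)
  where open ℚᵘₚ.≤-Reasoning

/-*-/ : ∀ a b c d .⦃ _ : NonZero b ⦄ .⦃ _ : NonZero d ⦄ .⦃ _ : NonZero (b ℕ.* d) ⦄ →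
        (+ a / b) ℚ.* (+ c / d) ≡ + (a ℕ.* c) / (b ℕ.* d)
/-*-/ a b@(suc b-1) c d@(suc d-1) = ℚₚ.toℚᵘ-injective (begin
  toℚᵘ ((+ a / b) ℚ.* (+ c / d))           ≈⟨ ℚₚ.toℚᵘ-homo-* (+ a / b) (+ c / d) ⟩
  toℚᵘ (+ a / b) ℚᵘ.* toℚᵘ (+ c / d)
    ≈⟨ ℚᵘₚ.*-cong (ℚₚ.toℚᵘ-fromℚᵘ (mkℚᵘ (+ a) b-1)) (ℚₚ.toℚᵘ-fromℚᵘ (mkℚᵘ (+ c) d-1)) ⟩
  mkℚᵘ (+ a) b-1 ℚᵘ.* mkℚᵘ (+ c) d-1       ≈⟨ ℚᵘ.*≡* (cong (ℤ._* + (b ℕ.* d)) (ℤₚ.pos-* a c)) ⟨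
  mkℚᵘ (+ (a ℕ.* c)) (ℕ.pred (b ℕ.* d))    ≈⟨ ℚₚ.toℚᵘ-fromℚᵘ (mkℚᵘ (+ (a ℕ.* c)) (ℕ.pred (b ℕ.* d))) ⟨
  toℚᵘ (+ (a ℕ.* c) / (b ℕ.* d))           ∎)
  where open import Relation.Binary.Reasoning.Setoid ℚᵘₚ.≃-setoid

/-+-/ : ∀ a c n .⦃ _ : NonZero n ⦄ → (+ a / n) ℚ.+ (+ c / n) ≡ + (a ℕ.+ c) / n
/-+-/ a c n@(suc n-1) = ℚₚ.toℚᵘ-injective (begin
  toℚᵘ ((+ a / n) ℚ.+ (+ c / n))           ≈⟨ ℚₚ.toℚᵘ-homo-+ (+ a / n) (+ c / n) ⟩
  toℚᵘ (+ a / n) ℚᵘ.+ toℚᵘ (+ c / n)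
    ≈⟨ ℚᵘₚ.+-cong (ℚₚ.toℚᵘ-fromℚᵘ (mkℚᵘ (+ a) n-1)) (ℚₚ.toℚᵘ-fromℚᵘ (mkℚᵘ (+ c) n-1)) ⟩
  mkℚᵘ (+ a) n-1 ℚᵘ.+ mkℚᵘ (+ c) n-1       ≈⟨ ℚᵘ.*≡* eq ⟩
  mkℚᵘ (+ (a ℕ.+ c)) n-1                   ≈⟨ ℚₚ.toℚᵘ-fromℚᵘ (mkℚᵘ (+ (a ℕ.+ c)) n-1) ⟨
  toℚᵘ (+ (a ℕ.+ c) / n)                   ∎)
  where
  open import Relation.Binary.Reasoning.Setoid ℚᵘₚ.≃-setoid
  eq : (+ a ℤ.* + n ℤ.+ + c ℤ.* + n) ℤ.* + n ≡ + (a ℕ.+ c) ℤ.* + (n ℕ.* n)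
  eq = trans (cong (ℤ._* + n) (sym (ℤₚ.*-distribʳ-+ (+ n) (+ a) (+ c))))
      (trans (ℤₚ.*-assoc (+ (a ℕ.+ c)) (+ n) (+ n)) (cong (+ (a ℕ.+ c) ℤ.*_) (sym (ℤₚ.pos-* n n))))

n/n≡1 : ∀ n .⦃ _ : NonZero n ⦄ → + n / n ≡ 1ℚ
n/n≡1 n@(suc n-1) = ℚₚ.toℚᵘ-injective (begin
  toℚᵘ (+ n / n)     ≈⟨ ℚₚ.toℚᵘ-fromℚᵘ (mkℚᵘ (+ n) n-1) ⟩
  mkℚᵘ (+ n) n-1     ≈⟨ ℚᵘ.*≡* (ℤₚ.*-comm (+ n) (+ 1)) ⟩
  ℚᵘ.1ℚᵘ             ∎)
  where open import Relation.Binary.Reasoning.Setoid ℚᵘₚ.≃-setoid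

1-/ : ∀ a c n .⦃ _ : NonZero n ⦄ → a ℕ.+ c ≡ n → 1ℚ ℚ.- (+ a / n) ≡ + c / n
1-/ a c n a+c≡n = begin
  1ℚ ℚ.- u                     ≡⟨ cong (ℚ._- u) (n/n≡1 n) ⟨
  (+ n / n) ℚ.- u              ≡⟨ cong (λ m → (+ m / n) ℚ.- u) (trans (ℕₚ.+-comm c a) a+c≡n) ⟨
  (+ (c ℕ.+ a) / n) ℚ.- u      ≡⟨ cong (ℚ._- u) (/-+-/ c a n) ⟨
  (v ℚ.+ u) ℚ.- u              ≡⟨ ℚₚ.+-assoc v u (ℚ.- u) ⟩
  v ℚ.+ (u ℚ.- u)              ≡⟨ cong (v ℚ.+_) (ℚₚ.+-inverseʳ u) ⟩
  v ℚ.+ 0ℚ                     ≡⟨ ℚₚ.+-identityʳ v ⟩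
  v                            ∎
  where
  open ≡-Reasoning
  u = + a / n
  v = + c / n

0≤/ : ∀ a n .⦃ _ : NonZero n ⦄ → 0ℚ ℚ.≤ + a / n
0≤/ a n = /-mono-≤ 0 1 a n ℕ.z≤n

p≤p+q : ∀ p {q} → 0ℚ ℚ.≤ q → p ℚ.≤ p ℚ.+ q
p≤p+q p {q} 0≤q = subst (ℚ._≤ p ℚ.+ q) (ℚₚ.+-identityʳ p) (ℚₚ.+-monoʳ-≤ p 0≤q)

p≤q+p : ∀ p {q} → 0ℚ ℚ.≤ q → p ℚ.≤ q ℚ.+ p
p≤q+p p {q} 0≤q = subst (ℚ._≤ q ℚ.+ p) (ℚₚ.+-identityˡ p) (ℚₚ.+-monoˡ-≤ p 0≤q)

-- The form in which one summand of a defect is discarded. The cardinalities that serve as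
-- denominators equal q + k only propositionally, hence the separate hypothesis `b ≡ N`.
/≤/+/ˡ : ∀ k N a b c d .⦃ _ : NonZero N ⦄ .⦃ _ : NonZero b ⦄ .⦃ _ : NonZero d ⦄ →
          b ≡ N → k ℕ.≤ a → + k / N ℚ.≤ (+ a / b) ℚ.+ (+ c / d)
/≤/+/ˡ k N a b c d eq k≤a =
  ℚₚ.≤-trans (/-mono-≤ k N a b (ℕₚ.*-mono-≤ k≤a (ℕₚ.≤-reflexive eq))) (p≤p+q (+ a / b) (0≤/ c d))

/≤/+/ʳ : ∀ k N a b c d .⦃ _ : NonZero N ⦄ .⦃ _ : NonZero b ⦄ .⦃ _ : NonZero d ⦄ →
          d ≡ N → k ℕ.≤ c → + k / N ℚ.≤ (+ a / b) ℚ.+ (+ c / d)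
/≤/+/ʳ k N a b c d eq k≤c =
  ℚₚ.≤-trans (/-mono-≤ k N c d (ℕₚ.*-mono-≤ k≤c (ℕₚ.≤-reflexive eq))) (p≤q+p (+ c / d) (0≤/ a b))

-- The point and sphere families

length-filter-map : ∀ {A B : Set} {R : B → Set} (R? : U.Decidable R) (f : A → B) xs →
                    length (filter R? (map f xs)) ≡ length (filter (R? ∘ f) xs)
length-filter-map R? f []       = refl
length-filter-map R? f (x ∷ xs) with R? (f x)
... | yes _ = cong suc (length-filter-map R? f xs)
... | no  _ = length-filter-map R? f xs

length-filter-++ : ∀ {A : Set} {R : A → Set} (R? : U.Decidable R) xs ys →
                   length (filter R? (xs ++ ys)) ≡ length (filter R? xs) ℕ.+ length (filter R? ys)
length-filter-++ R? xs ys = trans (cong length (filter-++ R? xs ys)) (length-++ (filter R? xs))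

length-filter-product : ∀ {A B : Set} {R : A × B → Set} (R? : U.Decidable R) n xs ys →
  All (λ x → length (filter (R? ∘ (x ,_)) ys) ≡ n) xs →
  length (filter R? (cartesianProduct xs ys)) ≡ length xs ℕ.* n
length-filter-product R? n []       ys []       = refl
length-filter-product R? n (x ∷ xs) ys (e ∷ es) =
  trans (length-filter-++ R? (map (x ,_) ys) (cartesianProduct xs ys))
        (cong₂ ℕ._+_ (trans (length-filter-map R? (x ,_) ys) e) (length-filter-product R? n xs ys es))

-- Guarantees q - 1 nonzero field elements, from which `units` can be taken.
length≤1+filter-≢ : ∀ {A : Set} (_≟_ : DecidableEquality A) a {xs} → Unique xs →
                    length xs ℕ.≤ suc (length (filter (¬? ∘ (_≟ a)) xs))
length≤1+filter-≢ _≟_ a [] = z≤n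
length≤1+filter-≢ _≟_ a {x ∷ xs} (x∉xs ∷ unique) with x ≟ a
... | no _     = s≤s (length≤1+filter-≢ _≟_ a unique)
... | yes refl = s≤s (ℕₚ.≤-reflexive (cong length (sym
  (filter-all (¬? ∘ (_≟ a)) (All.map (λ a≢y y≡a → a≢y (sym y≡a)) x∉xs)))))

module Construction {q} (F : FiniteField q) (2≢0 : FiniteField.2# F ≢ FiniteField.0# F)
                    (k : ℕ) ⦃ _ : NonZero k ⦄ (k<q : k ℕ.< q) where
  open FiniteField F
  open FieldProperties F hiding (2≢0)
  open HyperbolicForm F
  open QuadraticForm hyperbolicForm using (⟨_,_⟩)

  instance
    q+k≢0 : NonZero (q ℕ.+ k)
    q+k≢0 = ℕ.>-nonZero (ℕₚ.≤-trans (ℕ.>-nonZero⁻¹ k) (ℕₚ.m≤n+m k q))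

  elements-unique : Unique elements
  elements-unique = Uniqueₚ.map⁺ from-injective (Uniqueₚ.allFin⁺ q)
    where
    open Inverse enumeration using (to; from; strictlyInverseˡ)
    from-injective : ∀ {i j} → from i ≡ from j → i ≡ j
    from-injective {i} {j} eq = trans (sym (strictlyInverseˡ i)) (trans (cong to eq) (strictlyInverseˡ j))

  length-elements : length elements ≡ q
  length-elements = trans (length-map _ (allFin q)) (length-tabulate {n = q} _)

  -- Any k nonzero parameters serve. Zero is excluded because both kinds coincide there, and because
  -- nonincidence rests on a product of two parameters being nonzero.
  units : List Carrier
  units = take k (filter (¬? ∘ (_≟ 0#)) elements)

  units-unique : Unique units
  units-unique = Uniqueₚ.take⁺ k (Uniqueₚ.filter⁺ (¬? ∘ (_≟ 0#)) elements-unique)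

  units-≢0 : All (_≢ 0#) units
  units-≢0 = Allₚ.take⁺ k (Allₚ.all-filter (¬? ∘ (_≟ 0#)) elements)

  length-units : length units ≡ k
  length-units = trans (length-take k _) (ℕₚ.m≤n⇒m⊓n≡m (ℕ.s≤s⁻¹ (begin
    suc k                                                     ≤⟨ k<q ⟩
    q                                                         ≡⟨ length-elements ⟨
    length elements                                           ≤⟨ length≤1+filter-≢ _≟_ 0# elements-unique ⟩
    suc (length (filter (¬? ∘ (_≟ 0#)) elements))             ∎)))
    where open ℕₚ.≤-Reasoning

  -- Among these isotropic directions only `e₂` and `e₄` are nonorthogonal; a common multiple of
  -- `e₁` can therefore be shared by points and centres without spoiling any incidence.
  e₁ e₂ e₄ : Carrier → Point F 4
  e₁ t = t ∷ 0# ∷ 0# ∷ 0# ∷ []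
  e₂ t = 0# ∷ t ∷ 0# ∷ 0# ∷ []
  e₄ t = 0# ∷ 0# ∷ 0# ∷ t ∷ []

  -- One recipe for points and for spheres: a full line of parameters, followed by k nonzero
  -- parameters on a second line that meets the first only at its parameter zero.
  module Family {A : Set} (f g : Carrier → A)
    (f-injective : ∀ {s t} → f s ≡ f t → s ≡ t) (g-injective : ∀ {s t} → g s ≡ g t → s ≡ t)
    (f≡g⇒≡0 : ∀ {s t} → f s ≡ g t → t ≡ 0#) where

    list : List A
    list = map f elements ++ map g units

    length-list : length list ≡ q ℕ.+ k
    length-list = trans (length-++ (map f elements)) (cong₂ ℕ._+_
      (trans (length-map f elements) length-elements) (trans (length-map g units) length-units))

    family : NonemptyFiniteSet A
    family = record
      { members  = list
      ; distinct = Uniqueₚ.++⁺ (Uniqueₚ.map⁺ f-injective elements-unique) (Uniqueₚ.map⁺ g-injective units-unique)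
          λ (x∈f , x∈g) → disjoint (∈-map⁻ f x∈f) (∈-map⁻ g x∈g)
      ; nonempty = subst NonZero (sym length-list) q+k≢0
      }
      where
      disjoint : ∀ {x} → ∃[ s ] (s ∈ elements × x ≡ f s) → ¬ (∃[ t ] (t ∈ units × x ≡ g t))
      disjoint (s , _ , x≡fs) (t , t∈units , x≡gt) =
        All.lookup units-≢0 t∈units (f≡g⇒≡0 (trans (sym x≡fs) x≡gt))

  e₁-sphere e₄-sphere : Carrier → Sphere F 4
  e₁-sphere t = e₁ t , 0#
  e₄-sphere t = e₄ t , 0#

  e₁-injective : ∀ {s t} → e₁ s ≡ e₁ t → s ≡ t
  e₁-injective refl = refl

  e₂-injective : ∀ {s t} → e₂ s ≡ e₂ t → s ≡ t
  e₂-injective refl = refl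

  e₁≡e₂⇒≡0 : ∀ {s t} → e₁ s ≡ e₂ t → t ≡ 0#
  e₁≡e₂⇒≡0 refl = refl

  e₁-sphere-injective : ∀ {s t} → e₁-sphere s ≡ e₁-sphere t → s ≡ t
  e₁-sphere-injective refl = refl

  e₄-sphere-injective : ∀ {s t} → e₄-sphere s ≡ e₄-sphere t → s ≡ t
  e₄-sphere-injective refl = refl

  e₁-sphere≡e₄-sphere⇒≡0 : ∀ {s t} → e₁-sphere s ≡ e₄-sphere t → t ≡ 0#
  e₁-sphere≡e₄-sphere⇒≡0 refl = refl

  open Family e₁ e₂ e₁-injective e₂-injective e₁≡e₂⇒≡0
    public using () renaming (family to P; list to P-list; length-list to length-P)
  open Family e₁-sphere e₄-sphere e₁-sphere-injective e₄-sphere-injective e₁-sphere≡e₄-sphere⇒≡0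
    public using () renaming (family to S; list to S-list; length-list to length-S)

  e₁-e₁-incident : ∀ s t → OnSphere hyperbolicForm (e₁ s) (e₁-sphere t)
  e₁-e₁-incident s t rewrite -‿inverseʳ 0# | zeroʳ (s - t) | zeroʳ 0# = +-identityˡ 0#

  e₁-e₄-incident : ∀ s t → OnSphere hyperbolicForm (e₁ s) (e₄-sphere t)
  e₁-e₄-incident s t rewrite -‿inverseʳ 0# | zeroʳ (s - 0#) | zeroˡ (0# - t) = +-identityˡ 0#

  e₂-e₁-incident : ∀ s t → OnSphere hyperbolicForm (e₂ s) (e₁-sphere t)
  e₂-e₁-incident s t rewrite -‿inverseʳ 0# | zeroʳ (0# - t) | zeroʳ (s - 0#) = +-identityˡ 0#

  e₂-e₄-nonincident : ∀ {s t} → s ≢ 0# → t ≢ 0# → ¬ OnSphere hyperbolicForm (e₂ s) (e₄-sphere t)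
  e₂-e₄-nonincident {s} {t} s≢0 t≢0 eq
    rewrite -‿inverseʳ 0# | zeroʳ 0# | +-identityˡ ((s - 0#) * (0# - t)) | x-0≡x s | +-identityˡ (- t) =
    *-≢0 s≢0 (-‿≢0 t≢0) eq

  -- In odd characteristic `Λ` at x and a lifted sphere (c, r) is Q(x - c) - r, so this is
  -- nonincidence seen through the lift. Both values of the form vanish here and leave minus the
  -- product of s, 2t and 1/2, all nonzero.
  Λ-e₂-e₄≢0 : ∀ {s t} → s ≢ 0# → t ≢ 0# → Λ hyperbolicForm (e₂ s) (Φ hyperbolicForm (e₄-sphere t)) ≢ 0#
  Λ-e₂-e₄≢0 {s} {t} s≢0 t≢0 Λ≡0 = -‿≢0 (*-≢0 (*-≢0 s≢0 (*-≢0 2≢0 t≢0)) (⁻¹-≢0 2≢0)) (begin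
    - (s * (2# * t) * 2# ⁻¹)
      ≡⟨ cong (λ x → - (x * 2# ⁻¹)) polar≡ ⟨
    - (polar (e₂ s) (2# ·ᵥ e₄ t) * 2# ⁻¹)
      ≡⟨ cong -_ (half-difference (e₂ s) (2# ·ᵥ e₄ t)) ⟨
    - ⟨ e₂ s , 2# ·ᵥ e₄ t ⟩
      ≡⟨ trans (x-0≡x _) (+-identityˡ _) ⟨
    0# - ⟨ e₂ s , 2# ·ᵥ e₄ t ⟩ - 0#
      ≡⟨ cong₂ (λ x y → x - ⟨ e₂ s , 2# ·ᵥ e₄ t ⟩ - y) form-e₂ (trans (cong (λ x → 0# - x) form-e₄) (-‿inverseʳ 0#)) ⟨
    Λ hyperbolicForm (e₂ s) (Φ hyperbolicForm (e₄-sphere t))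
      ≡⟨ Λ≡0 ⟩
    0# ∎)
    where
    open ≡-Reasoning
    form-e₂ : hyperbolic (e₂ s) ≡ 0#
    form-e₂ = trans (cong₂ _+_ (zeroʳ 0#) (zeroʳ s)) (+-identityˡ 0#)
    form-e₄ : hyperbolic (e₄ t) ≡ 0#
    form-e₄ = trans (cong₂ _+_ (zeroʳ 0#) (zeroˡ t)) (+-identityˡ 0#)
    polar≡ : polar (e₂ s) (2# ·ᵥ e₄ t) ≡ s * (2# * t)
    polar≡ rewrite zeroʳ 2# | zeroʳ 0# | +-identityˡ (s * (2# * t)) | +-identityˡ 0# = +-identityʳ _

  -- Row by row: an `e₁`-point lies on all q + k spheres, an `e₂`-point on exactly the q spheres
  -- centred on the `e₁`-line.
  incidences≡ : incidences hyperbolicForm P S ≡ q ℕ.* (q ℕ.+ k) ℕ.+ k ℕ.* q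
  incidences≡ = begin
    length (filter R? (cartesianProduct (map e₁ elements ++ map e₂ units) S-list))
      ≡⟨ cong (length ∘ filter R?) (cartesianProductWith-distribʳ-++ _,_ (map e₁ elements) (map e₂ units) S-list) ⟩
    length (filter R? (cartesianProduct (map e₁ elements) S-list ++ cartesianProduct (map e₂ units) S-list))
      ≡⟨ length-filter-++ R? (cartesianProduct (map e₁ elements) S-list) _ ⟩
    length (filter R? (cartesianProduct (map e₁ elements) S-list)) ℕ.+
    length (filter R? (cartesianProduct (map e₂ units) S-list))
      ≡⟨ cong₂ ℕ._+_ (length-filter-product R? (q ℕ.+ k) (map e₁ elements) S-list
                       (Allₚ.map⁺ (All.universal e₁-count elements)))
                     (length-filter-product R? q (map e₂ units) S-list
                       (Allₚ.map⁺ (All.map e₂-count units-≢0))) ⟩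
    length (map e₁ elements) ℕ.* (q ℕ.+ k) ℕ.+ length (map e₂ units) ℕ.* q
      ≡⟨ cong₂ (λ m n → m ℕ.* (q ℕ.+ k) ℕ.+ n ℕ.* q)
           (trans (length-map e₁ elements) length-elements) (trans (length-map e₂ units) length-units) ⟩
    q ℕ.* (q ℕ.+ k) ℕ.+ k ℕ.* q ∎
    where
    open ≡-Reasoning
    R? : U.Decidable λ ((p , s) : Point F 4 × Sphere F 4) → OnSphere hyperbolicForm p s
    R? (p , s) = onSphere? hyperbolicForm p s
    e₁-count : ∀ t → length (filter (R? ∘ (e₁ t ,_)) S-list) ≡ q ℕ.+ k
    e₁-count t = trans (cong length (filter-all (R? ∘ (e₁ t ,_)) (Allₚ.++⁺
      (Allₚ.map⁺ (All.universal (e₁-e₁-incident t) elements))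
      (Allₚ.map⁺ (All.universal (e₁-e₄-incident t) units))))) length-S
    e₂-count : ∀ {t} → t ≢ 0# → length (filter (R? ∘ (e₂ t ,_)) S-list) ≡ q
    e₂-count {t} t≢0 = begin
      length (filter (R? ∘ (e₂ t ,_)) S-list)
        ≡⟨ length-filter-++ (R? ∘ (e₂ t ,_)) (map e₁-sphere elements) (map e₄-sphere units) ⟩
      length (filter (R? ∘ (e₂ t ,_)) (map e₁-sphere elements)) ℕ.+
      length (filter (R? ∘ (e₂ t ,_)) (map e₄-sphere units))
        ≡⟨ cong₂ (λ xs ys → length xs ℕ.+ length ys)
             (filter-all (R? ∘ (e₂ t ,_)) (Allₚ.map⁺ (All.universal (e₂-e₁-incident t) elements)))
             (filter-none (R? ∘ (e₂ t ,_)) (Allₚ.map⁺ (All.map (e₂-e₄-nonincident t≢0) units-≢0))) ⟩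
      length (map e₁-sphere elements) ℕ.+ 0
        ≡⟨ trans (ℕₚ.+-identityʳ _) (trans (length-map e₁-sphere elements) length-elements) ⟩
      q ∎

  -- The complement of the incidences consists of the k · k pairs of an `e₂`-point and an
  -- `e₄`-sphere.
  μ≡ : ⦃ _ : NonZero ((q ℕ.+ k) ℕ.* (q ℕ.+ k)) ⦄ → μ hyperbolicForm P S ≡ + (k ℕ.* k) / ((q ℕ.+ k) ℕ.* (q ℕ.+ k))
  μ≡ = trans (cong (λ x → 1ℚ ℚ.- x) (ℚₚ./-cong {q₁ = ∣ P ∣ ℕ.* ∣ S ∣}
    ⦃ ℕₚ.m*n≢0 ∣ P ∣ ∣ S ∣ ⦃ ∣∣-nonZero {P = P} ⦄ ⦃ ∣∣-nonZero {P = S} ⦄ ⦄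
    (cong +_ incidences≡) (cong₂ ℕ._*_ length-P length-S)))
             (1-/ _ (k ℕ.* k) _ (square q k))
    where
    square : ∀ q k → q ℕ.* (q ℕ.+ k) ℕ.+ k ℕ.* q ℕ.+ k ℕ.* k ≡ (q ℕ.+ k) ℕ.* (q ℕ.+ k)
    square = solve-∀

  all-counted : ∀ {A : Set} {R : A → Set} (R? : U.Decidable R) (f g : Carrier → A) →
    All R (map g units) → k ℕ.≤ length (filter R? (map f elements ++ map g units))
  all-counted R? f g all-R = begin
    k                                                        ≡⟨ trans (length-map g units) length-units ⟨
    length (map g units)                                     ≡⟨ cong length (filter-all R? all-R) ⟨
    length (filter R? (map g units))                         ≤⟨ ℕₚ.m≤n+m _ _ ⟩
    _ ℕ.+ length (filter R? (map g units))
      ≡⟨ length-filter-++ R? (map f elements) (map g units) ⟨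
    length (filter R? (map f elements ++ map g units))       ∎
    where open ℕₚ.≤-Reasoning

  -- Lower bound for the linear distance

  module _ (L : AdmissibleSubspace hyperbolicForm) where
    private
      outsideB? : U.Decidable λ x → ¬ B hyperbolicForm (proj₁ L) x
      outsideB? = ¬? ∘ B? hyperbolicForm (proj₁ L)

      outside𝒮? : U.Decidable λ s → ¬ 𝒮 hyperbolicForm (proj₁ L) s
      outside𝒮? = ¬? ∘ 𝒮? hyperbolicForm (proj₁ L)

    defect≥ˡ : k ℕ.≤ length (filter outsideB? P-list) → + k / (q ℕ.+ k) ℚ.≤ defect hyperbolicForm P S L
    defect≥ˡ = /≤/+/ˡ k (q ℕ.+ k) (length (filter outsideB? P-list)) (∣ P ∣) (length (filter outside𝒮? S-list)) (∣ S ∣)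
      ⦃ q+k≢0 ⦄ ⦃ ∣∣-nonZero {P = P} ⦄ ⦃ ∣∣-nonZero {P = S} ⦄ length-P

    defect≥ʳ : k ℕ.≤ length (filter outside𝒮? S-list) → + k / (q ℕ.+ k) ℚ.≤ defect hyperbolicForm P S L
    defect≥ʳ = /≤/+/ʳ k (q ℕ.+ k) (length (filter outsideB? P-list)) (∣ P ∣) (length (filter outside𝒮? S-list)) (∣ S ∣)
      ⦃ q+k≢0 ⦄ ⦃ ∣∣-nonZero {P = P} ⦄ ⦃ ∣∣-nonZero {P = S} ⦄ length-S

    -- B L cannot meet the e₂-points while 𝒮 L contains an e₄-sphere, because Λ would vanish there.
    e₄-spheres-outside : Any (B hyperbolicForm (proj₁ L)) (map e₂ units) →
                         All (λ s → ¬ 𝒮 hyperbolicForm (proj₁ L) s) (map e₄-sphere units)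
    e₄-spheres-outside some with find some
    ... | x , x∈e₂ , x∈B with ∈-map⁻ e₂ x∈e₂
    ...   | s , s∈units , refl = Allₚ.map⁺ (All.map
      (λ t≢0 t∈𝒮 → Λ-e₂-e₄≢0 (All.lookup units-≢0 s∈units) t≢0 (x∈B _ t∈𝒮)) units-≢0)

    -- Either every `e₂`-point or every `e₄`-sphere is lost, and these k members alone bring one of
    -- the two summands to k / (q + k).
    defect≥ : + k / (q ℕ.+ k) ℚ.≤ defect hyperbolicForm P S L
    defect≥ = [ (λ some → defect≥ʳ (all-counted outside𝒮? e₁-sphere e₄-sphere (e₄-spheres-outside some)))
              , (λ none → defect≥ˡ (all-counted outsideB? e₁ e₂ (Allₚ.¬Any⇒All¬ (map e₂ units) none)))
              ]′ (toSum (any? (B? hyperbolicForm (proj₁ L)) (map e₂ units)))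

  distLin≥ : + k / (q ℕ.+ k) ℚ.≤ distLin hyperbolicForm P S
  distLin≥ = proj₂ (distLin-isInfimum hyperbolicForm P S) _ defect≥

-- Powers of rationals

open import Data.Rational.Base using (_*_; _≤_; _<_)

/-mono-< : ∀ a b c d .⦃ _ : NonZero b ⦄ .⦃ _ : NonZero d ⦄ →
           a ℕ.* d ℕ.< c ℕ.* b → + a / b < + c / d
/-mono-< a b@(suc b-1) c d@(suc d-1) ad<cb = ℚₚ.toℚᵘ-cancel-< (begin-strict
  toℚᵘ (+ a / b)    ≃⟨ ℚₚ.toℚᵘ-fromℚᵘ (mkℚᵘ (+ a) b-1) ⟩
  mkℚᵘ (+ a) b-1    <⟨ ℚᵘ.*<* (subst₂ ℤ._<_ (ℤₚ.pos-* a d) (ℤₚ.pos-* c b) (ℤ.+<+ ad<cb)) ⟩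
  mkℚᵘ (+ c) d-1    ≃⟨ ℚₚ.toℚᵘ-fromℚᵘ (mkℚᵘ (+ c) d-1) ⟨
  toℚᵘ (+ c / d)    ∎)
  where open ℚᵘₚ.≤-Reasoning

/-cancel-≤ : ∀ a b c d .⦃ _ : NonZero b ⦄ .⦃ _ : NonZero d ⦄ →
             + a / b ≤ + c / d → a ℕ.* d ℕ.≤ c ℕ.* b
/-cancel-≤ a b c d a/b≤c/d = ℕₚ.≮⇒≥ λ cb<ad → ℚₚ.<-irrefl refl (ℚₚ.<-≤-trans (/-mono-< c d a b cb<ad) a/b≤c/d)

/-^ℚ : ∀ a b n .⦃ _ : NonZero b ⦄ .⦃ _ : NonZero (b ℕ.^ n) ⦄ → (+ a / b) ^ℚ n ≡ + (a ℕ.^ n) / (b ℕ.^ n)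
/-^ℚ a b zero            = refl
/-^ℚ a b (suc n) ⦃ b≢0 ⦄ = trans (cong ((+ a / b) *_) (/-^ℚ a b n)) (/-*-/ a b (a ℕ.^ n) (b ℕ.^ n))
  where
  instance
    bⁿ≢0 : NonZero (b ℕ.^ n)
    bⁿ≢0 = ℕₚ.m^n≢0 b n

0≤p*q : ∀ {p q} → 0ℚ ≤ p → 0ℚ ≤ q → 0ℚ ≤ p * q
0≤p*q {p} {q} 0≤p 0≤q = subst (_≤ p * q) (ℚₚ.*-zeroʳ p) (ℚₚ.*-monoˡ-≤-nonNeg p ⦃ ℚ.nonNegative 0≤p ⦄ 0≤q)

*-mono-≤-nonNeg : ∀ {p q r s} → 0ℚ ≤ p → 0ℚ ≤ r → p ≤ q → r ≤ s → p * r ≤ q * s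
*-mono-≤-nonNeg {p} {q} {r} {s} 0≤p 0≤r p≤q r≤s = ℚₚ.≤-trans
  (ℚₚ.*-monoʳ-≤-nonNeg r ⦃ ℚ.nonNegative 0≤r ⦄ p≤q)
  (ℚₚ.*-monoˡ-≤-nonNeg q ⦃ ℚ.nonNegative (ℚₚ.≤-trans 0≤p p≤q) ⦄ r≤s)

0≤^ℚ : ∀ {p} n → 0ℚ ≤ p → 0ℚ ≤ p ^ℚ n
0≤^ℚ zero    0≤p = ℚ.*≤* (ℤ.+≤+ z≤n)
0≤^ℚ (suc n) 0≤p = 0≤p*q 0≤p (0≤^ℚ n 0≤p)

^ℚ-mono-≤ : ∀ {p q} n → 0ℚ ≤ p → p ≤ q → p ^ℚ n ≤ q ^ℚ n
^ℚ-mono-≤ zero    0≤p p≤q = ℚₚ.≤-refl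
^ℚ-mono-≤ (suc n) 0≤p p≤q = *-mono-≤-nonNeg 0≤p (0≤^ℚ n 0≤p) p≤q (^ℚ-mono-≤ n 0≤p p≤q)

-- Allows a rational constant to be enlarged to a natural number; denominators are at least 1, so
-- the numerator suffices.
p<1+∣↥p∣ : ∀ p → p < + suc ℤ.∣ ↥ p ∣ / 1
p<1+∣↥p∣ p@(mkℚ i d-1 _) = ℚₚ.toℚᵘ-cancel-<
  (ℚᵘₚ.<-respʳ-≃ (ℚᵘₚ.≃-sym (ℚₚ.toℚᵘ-fromℚᵘ (mkℚᵘ (+ suc ℤ.∣ i ∣) 0))) (ℚᵘ.*<* (lemma i)))
  where
  i<1+∣i∣ : ∀ i → i ℤ.< + suc ℤ.∣ i ∣
  i<1+∣i∣ (+ n)    = ℤ.+<+ (ℕₚ.n<1+n n)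
  i<1+∣i∣ -[1+ _ ] = ℤ.-<+
  lemma : ∀ i → i ℤ.* + 1 ℤ.< + suc ℤ.∣ i ∣ ℤ.* + suc d-1
  lemma i = begin-strict
    i ℤ.* + 1                        ≡⟨ ℤₚ.*-identityʳ i ⟩
    i                                <⟨ i<1+∣i∣ i ⟩
    + suc ℤ.∣ i ∣                    ≤⟨ ℤ.+≤+ (ℕₚ.m≤m*n (suc ℤ.∣ i ∣) (suc d-1)) ⟩
    + (suc ℤ.∣ i ∣ ℕ.* suc d-1)      ≡⟨ ℤₚ.pos-* (suc ℤ.∣ i ∣) (suc d-1) ⟩
    + suc ℤ.∣ i ∣ ℤ.* + suc d-1      ∎
    where open ℤₚ.≤-Reasoning

½<⇒fraction : ∀ s → ½ < s → ∃[ m ] ∃[ n ] Σ[ n≢0 ∈ NonZero n ] n ℕ.< m ℕ.* 2 × s ≡ _/_ (+ m) n ⦃ n≢0 ⦄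
½<⇒fraction s@(mkℚ (+ m) d-1 _) ½<s = m , suc d-1 , _ ,
  ℤₚ.drop‿+<+ (subst₂ ℤ._<_ (ℤₚ.*-identityˡ (+ suc d-1)) (sym (ℤₚ.pos-* m 2)) (ℚₚ.drop-*<* ½<s)) ,
  sym (ℚₚ.↥p/↧p≡p s)
½<⇒fraction (mkℚ -[1+ m ] d-1 _) (ℚ.*<* ())

-- Asymptotics

-- The root grows by at most one from n to n + 1, because n < (k + 1)² gives n + 1 ≤ (k + 1)² < (k +
-- 2)².
squareRoot : ∀ n → ∃[ k ] k ℕ.* k ℕ.≤ n × n ℕ.< suc k ℕ.* suc k
squareRoot zero    = 0 , z≤n , s≤s z≤n
squareRoot (suc n) with squareRoot n
... | k , k²≤n , n<[1+k]² with suc n ℕₚ.<? suc k ℕ.* suc k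
...   | yes 1+n< = k , ℕₚ.m≤n⇒m≤1+n k²≤n , 1+n<
...   | no ¬1+n< = suc k , ℕₚ.≮⇒≥ ¬1+n< , ℕₚ.≤-<-trans n<[1+k]² (ℕₚ.*-mono-< (ℕₚ.n<1+n (suc k)) (ℕₚ.n<1+n (suc k)))

m²<n²⇒m<n : ∀ {m n} → m ℕ.* m ℕ.< n ℕ.* n → m ℕ.< n
m²<n²⇒m<n m²<n² = ℕₚ.≰⇒> λ n≤m → ℕₚ.<⇒≱ m²<n² (ℕₚ.*-mono-≤ n≤m n≤m)

m²≤n⇒m<n : ∀ {n} m → 2 ℕ.≤ n → m ℕ.* m ℕ.≤ n → m ℕ.< n
m²≤n⇒m<n zero            2≤n _    = ℕₚ.<-≤-trans (s≤s z≤n) 2≤n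
m²≤n⇒m<n 1               2≤n _    = 2≤n
m²≤n⇒m<n m@(suc (suc _)) 2≤n m²≤n = ℕₚ.<-≤-trans (ℕₚ.m<m*n m m (s≤s (s≤s z≤n))) m²≤n

record Example (q : ℕ) (F : FiniteField q) (k : ℕ) : Set₁ where
  field
    Q             : QuadraticForm F 4
    P             : NonemptyFiniteSet (Point F 4)
    S             : NonemptyFiniteSet (Sphere F 4)
    nondegenerate : Nondegenerate Q
    wittIndex     : WittIndex Q 2
    q+k≢0         : NonZero (q ℕ.+ k)
    μ≡            : μ Q P S ≡ _/_ (+ (k ℕ.* k)) ((q ℕ.+ k) ℕ.* (q ℕ.+ k))
                      ⦃ ℕₚ.m*n≢0 (q ℕ.+ k) (q ℕ.+ k) ⦃ q+k≢0 ⦄ ⦃ q+k≢0 ⦄ ⦄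
    distLin≥      : _/_ (+ k) (q ℕ.+ k) ⦃ q+k≢0 ⦄ ≤ distLin Q P S

example : ∀ {q} (F : FiniteField q) → ¬ (2 ∣ q) → 2 ℕ.≤ q → ∀ k → 1 ℕ.≤ k → k ℕ.* k ℕ.≤ q → Example q F k
example {q} F ¬2∣q 2≤q k@(suc k-1) _ k²≤q = record
  { Q = hyperbolicForm ; P = P ; S = S ; nondegenerate = nondegenerate (2≢0 ¬2∣q) ; wittIndex = wittIndex
  ; q+k≢0 = q+k≢0 ; μ≡ = μ≡ ⦃ ℕₚ.m*n≢0 (q ℕ.+ k) (q ℕ.+ k) ⦄ ; distLin≥ = distLin≥ }
  where
  k<q : k ℕ.< q
  k<q = m²≤n⇒m<n k 2≤q k²≤q
  open FieldProperties F using (2≢0)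
  open HyperbolicForm F using (hyperbolicForm; nondegenerate; wittIndex)
  open Construction F (2≢0 ¬2∣q) k k<q

[a*a]^m≡a^[m*2] : ∀ a m → (a ℕ.* a) ℕ.^ m ≡ a ℕ.^ (m ℕ.* 2)
[a*a]^m≡a^[m*2] a zero    = refl
[a*a]^m≡a^[m*2] a (suc m) = trans (cong (a ℕ.* a ℕ.*_) ([a*a]^m≡a^[m*2] a m)) (ℕₚ.*-assoc a a _)

-- The inequality A x^(2m) < x^n for x = k / N, with denominators cleared. After cancelling x^n at
-- least one factor x remains; it is at most 1 / (k + 1) and so outweighs A, while the other factors
-- are at most 1.
power-gap : ∀ {A k N m n} .⦃ _ : NonZero k ⦄ → n ℕ.< m ℕ.* 2 → k ℕ.* suc k ℕ.≤ N → A ℕ.≤ k →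
            A ℕ.* (k ℕ.* k) ℕ.^ m ℕ.* N ℕ.^ n ℕ.< k ℕ.^ n ℕ.* (N ℕ.* N) ℕ.^ m
power-gap {A} {k} {N} {m} {n} n<2m k[1+k]≤N A≤k = begin-strict
  A ℕ.* (k ℕ.* k) ℕ.^ m ℕ.* N ℕ.^ n                      ≡⟨ cong (λ x → A ℕ.* x ℕ.* N ℕ.^ n) (split k) ⟩
  A ℕ.* (k ℕ.^ n ℕ.* (k ℕ.* k ℕ.^ r)) ℕ.* N ℕ.^ n        ≡⟨ rearrange A (k ℕ.^ n) (k ℕ.* k ℕ.^ r) (N ℕ.^ n) ⟩
  A ℕ.* (k ℕ.* k ℕ.^ r) ℕ.* (k ℕ.^ n ℕ.* N ℕ.^ n)        <⟨ ℕₚ.*-monoˡ-< (k ℕ.^ n ℕ.* N ℕ.^ n) gap ⟩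
  N ℕ.* N ℕ.^ r ℕ.* (k ℕ.^ n ℕ.* N ℕ.^ n)                ≡⟨ rearrange′ (N ℕ.* N ℕ.^ r) (k ℕ.^ n) (N ℕ.^ n) ⟩
  k ℕ.^ n ℕ.* (N ℕ.^ n ℕ.* (N ℕ.* N ℕ.^ r))              ≡⟨ cong (k ℕ.^ n ℕ.*_) (split N) ⟨
  k ℕ.^ n ℕ.* (N ℕ.* N) ℕ.^ m                            ∎
  where
  open ℕₚ.≤-Reasoning
  -- The surplus 2m - n is positive: one factor is set aside to absorb A, and r counts the others.
  r = m ℕ.* 2 ℕ.∸ suc n
  split : ∀ a → (a ℕ.* a) ℕ.^ m ≡ a ℕ.^ n ℕ.* (a ℕ.* a ℕ.^ r)
  split a = trans ([a*a]^m≡a^[m*2] a m) (trans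
    (cong (a ℕ.^_) (sym (trans (ℕₚ.+-suc n r) (ℕₚ.m+[n∸m]≡n n<2m)))) (ℕₚ.^-distribˡ-+-* a n (suc r)))
  rearrange : ∀ a b c d → a ℕ.* (b ℕ.* c) ℕ.* d ≡ a ℕ.* c ℕ.* (b ℕ.* d)
  rearrange = solve-∀
  rearrange′ : ∀ a b c → a ℕ.* (b ℕ.* c) ≡ b ℕ.* (c ℕ.* a)
  rearrange′ = solve-∀
  k≤N : k ℕ.≤ N
  k≤N = ℕₚ.≤-trans (ℕₚ.m≤m*n k (suc k)) k[1+k]≤N
  instance
    N≢0 : NonZero N
    N≢0 = ℕ.>-nonZero (ℕₚ.<-≤-trans (ℕ.>-nonZero⁻¹ k) k≤N)
    kⁿNⁿ≢0 : NonZero (k ℕ.^ n ℕ.* N ℕ.^ n)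
    kⁿNⁿ≢0 = ℕₚ.m*n≢0 (k ℕ.^ n) (N ℕ.^ n) ⦃ ℕₚ.m^n≢0 k n ⦄ ⦃ ℕₚ.m^n≢0 N n ⦄
    k¹⁺ʳ≢0 : NonZero (k ℕ.* k ℕ.^ r)
    k¹⁺ʳ≢0 = ℕₚ.m^n≢0 k (suc r)
  gap : A ℕ.* (k ℕ.* k ℕ.^ r) ℕ.< N ℕ.* N ℕ.^ r
  gap = begin-strict
    A ℕ.* (k ℕ.* k ℕ.^ r)         <⟨ ℕₚ.*-monoˡ-< (k ℕ.* k ℕ.^ r) (s≤s A≤k) ⟩
    suc k ℕ.* (k ℕ.* k ℕ.^ r)
      ≡⟨ trans (sym (ℕₚ.*-assoc (suc k) k _)) (cong (ℕ._* k ℕ.^ r) (ℕₚ.*-comm (suc k) k)) ⟩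
    k ℕ.* suc k ℕ.* k ℕ.^ r       ≤⟨ ℕₚ.*-mono-≤ k[1+k]≤N (ℕₚ.^-monoˡ-≤ r k≤N) ⟩
    N ℕ.* N ℕ.^ r                 ∎

module Estimates {q} {F : FiniteField q} {k} (E : Example q F k) where
  open Example E
  N = q ℕ.+ k
  instance
    N≢0 : NonZero N
    N≢0 = q+k≢0
    N²≢0 : NonZero (N ℕ.* N)
    N²≢0 = ℕₚ.m*n≢0 N N

  μ-upper : .⦃ _ : NonZero q ⦄ → k ℕ.* k ℕ.≤ q → μ Q P S ≤ 1ℚ * (+ 1 / q)
  μ-upper k²≤q = subst₂ _≤_ (sym μ≡) (sym (ℚₚ.*-identityˡ (+ 1 / q)))
    (/-mono-≤ (k ℕ.* k) (N ℕ.* N) 1 q (begin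
      k ℕ.* k ℕ.* q      ≤⟨ ℕₚ.*-monoˡ-≤ q k²≤q ⟩
      q ℕ.* q            ≤⟨ ℕₚ.*-mono-≤ (ℕₚ.m≤m+n q k) (ℕₚ.m≤m+n q k) ⟩
      N ℕ.* N            ≡⟨ ℕₚ.*-identityˡ (N ℕ.* N) ⟨
      1 ℕ.* (N ℕ.* N)    ∎))
    where open ℕₚ.≤-Reasoning

  -- The 16 is 4 · 4: N ≤ 2q costs one factor 4 in N², and q ≤ (2k)² the other.
  μ-lower : ∀ c .⦃ _ : NonZero q ⦄ .⦃ _ : NonZero c ⦄ → 16 ℕ.≤ c → k ℕ.≤ q → q ℕ.≤ (k ℕ.+ k) ℕ.* (k ℕ.+ k) →
            (+ 1 / c) * (+ 1 / q) ≤ μ Q P S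
  μ-lower c 16≤c k≤q q≤4k² = subst₂ _≤_ (sym (/-*-/ 1 c 1 q)) (sym μ≡)
    (/-mono-≤ 1 (c ℕ.* q) (k ℕ.* k) (N ℕ.* N) (begin
      1 ℕ.* (N ℕ.* N)                                  ≡⟨ ℕₚ.*-identityˡ (N ℕ.* N) ⟩
      N ℕ.* N
        ≤⟨ ℕₚ.*-mono-≤ (ℕₚ.+-monoʳ-≤ q k≤q) (ℕₚ.+-monoʳ-≤ q k≤q) ⟩
      (q ℕ.+ q) ℕ.* (q ℕ.+ q)                          ≡⟨ 4q² q ⟩
      q ℕ.* (4 ℕ.* q)                                  ≤⟨ ℕₚ.*-monoˡ-≤ (4 ℕ.* q) q≤4k² ⟩
      (k ℕ.+ k) ℕ.* (k ℕ.+ k) ℕ.* (4 ℕ.* q)            ≡⟨ 16k²q k q ⟩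
      k ℕ.* k ℕ.* (16 ℕ.* q)                           ≤⟨ ℕₚ.*-monoʳ-≤ (k ℕ.* k) (ℕₚ.*-monoˡ-≤ q 16≤c) ⟩
      k ℕ.* k ℕ.* (c ℕ.* q)                            ∎))
    where
    open ℕₚ.≤-Reasoning
    instance
      cq≢0 : NonZero (c ℕ.* q)
      cq≢0 = ℕₚ.m*n≢0 c q
    4q² : ∀ q → (q ℕ.+ q) ℕ.* (q ℕ.+ q) ≡ q ℕ.* (4 ℕ.* q)
    4q² = solve-∀
    16k²q : ∀ k q → (k ℕ.+ k) ℕ.* (k ℕ.+ k) ℕ.* (4 ℕ.* q) ≡ k ℕ.* k ℕ.* (16 ℕ.* q)
    16k²q = solve-∀

  -- Since `μ` is the exact square of k / N, any lower bound for `μ` passes to the square of the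
  -- distance.
  μ≤distLin² : μ Q P S ≤ distLin Q P S ^ℚ 2
  μ≤distLin² = begin
    μ Q P S                    ≡⟨ trans μ≡ (sym (/-*-/ k N k N)) ⟩
    (+ k / N) * (+ k / N)      ≡⟨ cong ((+ k / N) *_) (ℚₚ.*-identityʳ (+ k / N)) ⟨
    (+ k / N) ^ℚ 2             ≤⟨ ^ℚ-mono-≤ 2 (0≤/ k N) distLin≥ ⟩
    distLin Q P S ^ℚ 2         ∎
    where open ℚₚ.≤-Reasoning

  distLin-nonNeg : 0ℚ ≤ distLin Q P S
  distLin-nonNeg = ℚₚ.≤-trans (0≤/ k N) distLin≥

  -- From 3k ≤ N the value of `μ` is at most 1 / 9, and d < 9c places 1 / 9 below c / d.
  μ<fraction : ∀ c d .⦃ _ : NonZero d ⦄ .⦃ _ : NonZero k ⦄ → d ℕ.< c ℕ.* 9 → k ℕ.* 3 ℕ.≤ N → μ Q P S < + c / d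
  μ<fraction c d d<9c 3k≤N = subst (_< + c / d) (sym μ≡) (/-mono-< (k ℕ.* k) (N ℕ.* N) c d (begin-strict
    k ℕ.* k ℕ.* d                         <⟨ ℕₚ.*-monoʳ-< (k ℕ.* k) ⦃ ℕₚ.m*n≢0 k k ⦄ d<9c ⟩
    k ℕ.* k ℕ.* (c ℕ.* 9)                 ≡⟨ 9ck² k c ⟩
    c ℕ.* (k ℕ.* 3 ℕ.* (k ℕ.* 3))         ≤⟨ ℕₚ.*-monoʳ-≤ c (ℕₚ.*-mono-≤ 3k≤N 3k≤N) ⟩
    c ℕ.* (N ℕ.* N)                       ∎))
    where
    open ℕₚ.≤-Reasoning
    9ck² : ∀ k c → k ℕ.* k ℕ.* (c ℕ.* 9) ≡ c ℕ.* (k ℕ.* 3 ℕ.* (k ℕ.* 3))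
    9ck² = solve-∀

  -- The bound would persist with the distance lowered to k / N. Clearing denominators then
  -- contradicts `power-gap` with A = K^n.
  power-bound-fails : ∀ K m n .⦃ _ : NonZero k ⦄ → n ℕ.< m ℕ.* 2 → k ℕ.* suc k ℕ.≤ N → K ℕ.^ n ℕ.≤ k →
                      ¬ (distLin Q P S ^ℚ n ≤ (+ K / 1) ^ℚ n * μ Q P S ^ℚ m)
  power-bound-fails K m n n<2m k[1+k]≤N Kⁿ≤k bound =
    ℕₚ.<⇒≱ (power-gap {m = m} {n = n} n<2m k[1+k]≤N Kⁿ≤k) kⁿN²ᵐ≤
    where
    instance
      Nⁿ≢0 : NonZero (N ℕ.^ n)
      Nⁿ≢0 = ℕₚ.m^n≢0 N n
      1ⁿ≢0 : NonZero (1 ℕ.^ n)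
      1ⁿ≢0 = ℕₚ.m^n≢0 1 n
      N²ᵐ≢0 : NonZero ((N ℕ.* N) ℕ.^ m)
      N²ᵐ≢0 = ℕₚ.m^n≢0 (N ℕ.* N) m
      1ⁿN²ᵐ≢0 : NonZero (1 ℕ.^ n ℕ.* (N ℕ.* N) ℕ.^ m)
      1ⁿN²ᵐ≢0 = ℕₚ.m*n≢0 (1 ℕ.^ n) ((N ℕ.* N) ℕ.^ m)
    powers : + (k ℕ.^ n) / (N ℕ.^ n) ≤ + (K ℕ.^ n ℕ.* (k ℕ.* k) ℕ.^ m) / (1 ℕ.^ n ℕ.* (N ℕ.* N) ℕ.^ m)
    powers = begin
      + (k ℕ.^ n) / (N ℕ.^ n)
        ≡⟨ /-^ℚ k N n ⟨
      (+ k / N) ^ℚ n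
        ≤⟨ ^ℚ-mono-≤ n (0≤/ k N) distLin≥ ⟩
      distLin Q P S ^ℚ n
        ≤⟨ bound ⟩
      (+ K / 1) ^ℚ n * μ Q P S ^ℚ m
        ≡⟨ cong (λ x → (+ K / 1) ^ℚ n * x ^ℚ m) μ≡ ⟩
      (+ K / 1) ^ℚ n * (+ (k ℕ.* k) / (N ℕ.* N)) ^ℚ m
        ≡⟨ cong₂ _*_ (/-^ℚ K 1 n) (/-^ℚ (k ℕ.* k) (N ℕ.* N) m) ⟩
      (+ (K ℕ.^ n) / (1 ℕ.^ n)) * (+ ((k ℕ.* k) ℕ.^ m) / ((N ℕ.* N) ℕ.^ m))
        ≡⟨ /-*-/ (K ℕ.^ n) (1 ℕ.^ n) ((k ℕ.* k) ℕ.^ m) ((N ℕ.* N) ℕ.^ m) ⟩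
      + (K ℕ.^ n ℕ.* (k ℕ.* k) ℕ.^ m) / (1 ℕ.^ n ℕ.* (N ℕ.* N) ℕ.^ m) ∎
      where open ℚₚ.≤-Reasoning
    kⁿN²ᵐ≤ : k ℕ.^ n ℕ.* (N ℕ.* N) ℕ.^ m ℕ.≤ K ℕ.^ n ℕ.* (k ℕ.* k) ℕ.^ m ℕ.* N ℕ.^ n
    kⁿN²ᵐ≤ = subst (λ x → k ℕ.^ n ℕ.* x ℕ.≤ K ℕ.^ n ℕ.* (k ℕ.* k) ℕ.^ m ℕ.* N ℕ.^ n)
      (trans (cong (ℕ._* (N ℕ.* N) ℕ.^ m) (ℕₚ.^-zeroˡ n)) (ℕₚ.*-identityˡ _))
      (/-cancel-≤ (k ℕ.^ n) (N ℕ.^ n) (K ℕ.^ n ℕ.* (k ℕ.* k) ℕ.^ m) (1 ℕ.^ n ℕ.* (N ℕ.* N) ℕ.^ m) powers)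

asymptotics : ∀ {q} .⦃ _ : NonZero q ⦄ → 2 ℕ.≤ q → OddPrimePower q → (F : FiniteField q) →
  Σ[ Q ∈ QuadraticForm F 4 ] Σ[ P ∈ NonemptyFiniteSet (Point F 4) ] Σ[ S ∈ NonemptyFiniteSet (Sphere F 4) ]
    (Nondegenerate Q × WittIndex Q 2 ×
     (+ 1 / 16) * (+ 1 / q) ≤ μ Q P S × μ Q P S ≤ 1ℚ * (+ 1 / q) ×
     SqrtBound (+ 1 / 4) (+ 1 / q) (distLin Q P S))
asymptotics {q} 2≤q (¬2∣q , _) F =
  -- The square of 1 / 4 evaluates to 1 / 16, so `lower` serves both for `μ` and, through
  -- `μ≤distLin²`, for the square-root bound.
  Q , P , S , nondegenerate , wittIndex , lower , μ-upper k²≤q , distLin-nonNeg , ℚₚ.≤-trans lower μ≤distLin²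
  where
  k = proj₁ (squareRoot q)
  k²≤q : k ℕ.* k ℕ.≤ q
  k²≤q = proj₁ (proj₂ (squareRoot q))
  q<[1+k]² : q ℕ.< suc k ℕ.* suc k
  q<[1+k]² = proj₂ (proj₂ (squareRoot q))
  1≤k : 1 ℕ.≤ k
  1≤k = ℕ.s≤s⁻¹ (m²<n²⇒m<n (ℕₚ.<-trans 2≤q q<[1+k]²))
  E : Example q F k
  E = example F ¬2∣q 2≤q k 1≤k k²≤q
  open Example E
  open Estimates E
  lower : (+ 1 / 16) * (+ 1 / q) ≤ μ Q P S
  -- Here q < (k + 1)² ≤ (2k)², as 1 ≤ k.
  lower = μ-lower 16 ℕₚ.≤-refl (ℕₚ.<⇒≤ (m²≤n⇒m<n k 2≤q k²≤q))
    (ℕₚ.≤-trans (ℕₚ.<⇒≤ q<[1+k]²) (ℕₚ.*-mono-≤ (ℕₚ.+-monoˡ-≤ k 1≤k) (ℕₚ.+-monoˡ-≤ k 1≤k)))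

no-power-bound : ∀ K m n .⦃ _ : NonZero n ⦄ → n ℕ.< m ℕ.* 2 →
  ∃[ q ] OddPrimePower q × Σ[ F ∈ FiniteField q ] ∃[ k ] Σ[ E ∈ Example q F k ] (let open Example E in
    μ Q P S < + 5 / 36 × ¬ (distLin Q P S ^ℚ n ≤ (+ K / 1) ^ℚ n * μ Q P S ^ℚ m))
no-power-bound K m n n<2m =
  p , (¬2∣p , p , 1 , isPrime , s≤s z≤n , sym (ℕₚ.*-identityʳ p)) , F , k , E ,
  -- The threshold (d + 1) / (d + 2)² at d = 4 is 5 / 36, which exceeds 1 / 9 because 36 < 45.
  μ<fraction 5 36 (ℕₚ.m≤m+n 37 8)
    (ℕₚ.≤-trans (ℕₚ.*-monoʳ-≤ k (s≤s (ℕₚ.≤-trans (ℕₚ.m≤m+n 2 _) M≤k))) k[1+k]≤N) ,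
  power-bound-fails K m n n<2m k[1+k]≤N (ℕₚ.≤-trans (ℕₚ.m≤n+m _ 2) M≤k)
  where
  -- A prime above M² forces k ≥ M. The summand K^n lets k absorb the constant; the 2 gives 3k ≤ k
  -- (k + 1) ≤ N, and also makes the prime odd.
  M = 2 ℕ.+ K ℕ.^ n
  p = proj₁ (prime-above (M ℕ.* M))
  isPrime : Prime p
  isPrime = proj₁ (proj₂ (prime-above (M ℕ.* M)))
  M²<p : M ℕ.* M ℕ.< p
  M²<p = proj₂ (proj₂ (prime-above (M ℕ.* M)))
  k = proj₁ (squareRoot p)
  k²≤p : k ℕ.* k ℕ.≤ p
  k²≤p = proj₁ (proj₂ (squareRoot p))
  M≤k : M ℕ.≤ k
  M≤k = ℕ.s≤s⁻¹ (m²<n²⇒m<n (ℕₚ.<-trans M²<p (proj₂ (proj₂ (squareRoot p)))))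
  1≤k : 1 ℕ.≤ k
  1≤k = ℕₚ.≤-trans (s≤s z≤n) M≤k
  2<p : 2 ℕ.< p
  2<p = ℕₚ.≤-<-trans (ℕₚ.≤-trans (s≤s (s≤s z≤n)) (ℕₚ.m≤m*n M M)) M²<p
  k[1+k]≤N : k ℕ.* suc k ℕ.≤ p ℕ.+ k
  k[1+k]≤N = subst (ℕ._≤ p ℕ.+ k) (trans (ℕₚ.+-comm (k ℕ.* k) k) (sym (ℕₚ.*-suc k k))) (ℕₚ.+-monoˡ-≤ k k²≤p)
  instance
    p≢0 : NonZero p
    p≢0 = prime⇒nonZero isPrime
    k≢0 : NonZero k
    k≢0 = ℕ.>-nonZero 1≤k
  F : FiniteField p
  F = ModularArithmetic.field-mod p isPrime
  ¬2∣p : ¬ (2 ∣ p)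
  ¬2∣p = primes-odd isPrime 2<p
  E : Example p F k
  E = example F ¬2∣p (ℕₚ.<⇒≤ 2<p) k 1≤k k²≤p
  open Estimates E

-- `PowerBound` quantifies over rationals, so a single instance refutes it. Roundedness of the lower
-- cut of `e` yields a fraction m / n strictly between ½ and `e`; a rational from the upper cut of
-- `C` is enlarged to a natural K, which stays in that cut.
exponent-optimal : ∀ (C e : ℝ) → Below C 0ℚ → Below e ½ →
  ¬ (∀ (q : ℕ) → OddPrimePower q →
     ∀ (F : FiniteField q) (Q : QuadraticForm F 4) → Nondegenerate Q → WittIndex Q 2 →
     ∀ (P : NonemptyFiniteSet (Point F 4)) (S : NonemptyFiniteSet (Sphere F 4)) →
     μ Q P S < + (4 ℕ.+ 1) / ((4 ℕ.+ 2) ℕ.^ 2) →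
     PowerBound (distLin Q P S) C (μ Q P S) e)
exponent-optimal C e _ ½<e bound =
  let s , ½<s , s<e                = Equivalence.to (ℝ.below-rounded e ½) ½<e
      m , n , n≢0 , n<2m , s≡m/n   = ½<⇒fraction s ½<s
      _ , C<c                      = ℝ.above-inhabited C
  in refute C<c m n ⦃ n≢0 ⦄ n<2m (subst (Below e) s≡m/n s<e)
  where
  refute : ∀ {c} → Above C c → ∀ m n ⦃ _ : NonZero n ⦄ → n ℕ.< m ℕ.* 2 → ¬ Below e (+ m / n)
  refute {c} C<c m n n<2m m/n<e =
    let q , oddPrimePower , F , k , E , μ<5/36 , ¬bounded = no-power-bound K m n n<2m
        open Example E
    in ¬bounded (bound q oddPrimePower F Q nondegenerate wittIndex P S μ<5/36 (+ K / 1) C<K m n m/n<e)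
    where
    K = suc ℤ.∣ ↥ c ∣
    C<K : Above C (+ K / 1)
    C<K = Equivalence.from (ℝ.above-rounded C (+ K / 1)) (c , p<1+∣↥p∣ c , C<c)

proposition2p11 : (∃[ c₁ ] ∃[ c₂ ] ∃[ c₃ ]
    (0ℚ < c₁ × 0ℚ < c₂ × 0ℚ < c₃ ×
    (∃[ q₀ ] (∀ (q : ℕ) ⦃ _ : NonZero q ⦄ → q₀ ℕ.≤ q → OddPrimePower q →
    ∀ (F : FiniteField q) →
    Σ[ Q ∈ QuadraticForm F 4 ]
    Σ[ P ∈ NonemptyFiniteSet (Point F 4) ]
    Σ[ S ∈ NonemptyFiniteSet (Sphere F 4) ]
    (Nondegenerate Q × WittIndex Q 2 ×
    c₁ * (+ 1 / q) ≤ μ Q P S × μ Q P S ≤ c₂ * (+ 1 / q) ×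
    SqrtBound c₃ (+ 1 / q) (distLin Q P S))))))
    ×
    (∀ (C e : ℝ) → Below C 0ℚ → Below e ½ →
    ¬ (∀ (q : ℕ) → OddPrimePower q →
    ∀ (F : FiniteField q) (Q : QuadraticForm F 4) → Nondegenerate Q → WittIndex Q 2 →
    ∀ (P : NonemptyFiniteSet (Point F 4)) (S : NonemptyFiniteSet (Sphere F 4)) →
    μ Q P S < + (4 ℕ.+ 1) / ((4 ℕ.+ 2) ℕ.^ 2) →
    PowerBound (distLin Q P S) C (μ Q P S) e))
proposition2p11 =
  (+ 1 / 16 , 1ℚ , + 1 / 4 ,
   /-mono-< 0 1 1 16 (s≤s z≤n) , /-mono-< 0 1 1 1 (s≤s z≤n) , /-mono-< 0 1 1 4 (s≤s z≤n) ,
   -- From 2 ≤ q on, the integer square root k satisfies 1 ≤ k < q, as the construction requires.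
   2 , λ q → asymptotics) ,
  exponent-optimal
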